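{- For every integer $d \geq 2$ and all $k, m \in \mathbb{N}_{+}$, there is a strategy for Presenter in the on-line $(k,d)$ interval coloring game that forces Algorithm to use at least $(5m-3)\frac{d}{\log d + 3}$ different colors while the constructed set of intervals is $m\left(\frac{d}{k} + \log d + 3\right)$-colorable. Here $\log$ denotes the logarithm to base $2$.
   Context: Intervals are closed intervals $[l,r]$ on the real line. Each interval carries a $d$-dimensional vector of weights from $[0,1]^d$. Intervals are treated as individual objects: several presented intervals may have the same endpoints. A $(k,d)$-coloring of a finite collection of weighted intervals is an assignment of colors to the intervals such that for each color $\gamma$ and each point $p$ of the real line: the number of intervals containing $p$ and colored $\gamma$ does not exceed $k$, and the sum of the weight vectors of the intervals containing $p$ and colored $\gamma$ does not exceed $1$ in any of the $d$ coordinates. For a real number $x$, a finite collection of weighted intervals is $x$-colorable if it has a $(k,d)$-coloring using at most $x$ colors. The on-line $(k,d)$ interval coloring game is played by Presenter and Algorithm. In each round Presenter introduces a new interval with a $d$-dimensional vector of weights from $[0,1]$. Algorithm irrevocably assigns a color to it, before the next interval is introduced, so that the coloring of all intervals presented so far is a $(k,d)$-coloring. Algorithm may use any number of colors and aims to minimize the number of different colors used. Presenter presents finitely many intervals and then the game ends. A strategy for Presenter "forces Algorithm to use at least $c$ colors while the constructed set of intervals is $x$-colorable" if, whatever valid choices Algorithm makes, at the end of the game played against this strategy Algorithm has used at least $c$ different colors and the collection of all presented weighted intervals is $x$-colorable. -}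

module Defs where

open import Data.Bool.Base using (if_then_else_)
open import Data.Empty using (⊥-elim)
open import Data.Fin.Base using (Fin)
open import Data.Fin.Subset using (Subset; _∈_; ∣_∣)
open import Data.Integer.Base as ℤ using (+_; -[1+_])
import Data.Integer.Properties as ℤ
open import Data.List.Base using (length; deduplicate)
open import Data.Nat.Base as ℕ using (ℕ; zero; suc; z≤n; s≤s; ⌊_/2⌋)
import Data.Nat.Properties as ℕ
open import Data.Nat.Logarithm using (⌊log₂_⌋; ⌊log₂⌋-mono-≤; ⌊log₂[2^n]⌋≡n)
open import Data.Nat.Logarithm.Core using (⌊log2⌋)
open import Data.Nat.Induction using (<-wellFounded)
import Data.Nat.Tactic.RingSolver as ℕSolver
open import Data.Product using (∃-syntax; _×_; _,_)
open import Data.Rational.Base as ℚ using (ℚ; mkℚ; 0ℚ; 1ℚ; ½)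
import Data.Rational.Properties as ℚ
import Data.Rational.Solver as ℚSolver
import Data.Rational.Unnormalised.Base as ℚᵘ
import Data.Rational.Unnormalised.Properties as ℚᵘ
open import Data.Sum.Base using (inj₁; inj₂)
open import Data.Vec.Base using (Vec; []; _∷_; lookup; toList)
import Data.Vec.Functional as Vector
open import Function.Bundles using (_⇔_)
open import Induction.WellFounded using (Acc; acc)
open import Relation.Binary.PropositionalEquality
open import Relation.Nullary using (yes; no)

dist-refl : ∀ p → ℚ.∣ p ℚ.- p ∣ ≡ 0ℚ
dist-refl p = cong ℚ.∣_∣ (ℚ.+-inverseʳ p)

0<½* : ∀ {ε} → 0ℚ ℚ.< ε → 0ℚ ℚ.< ½ ℚ.* ε
0<½* {ε} 0<ε = subst (ℚ._< ½ ℚ.* ε) (ℚ.*-zeroʳ ½) (ℚ.*-monoʳ-<-pos ½ 0<ε)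

½*+½* : ∀ ε → ½ ℚ.* ε ℚ.+ ½ ℚ.* ε ≡ ε
½*+½* ε = trans (sym (ℚ.*-distribʳ-+ ε ½ ½)) (ℚ.*-identityˡ ε)

0<* : ∀ {p q} → 0ℚ ℚ.< p → 0ℚ ℚ.< q → 0ℚ ℚ.< p ℚ.* q
0<* {p} {q} 0<p 0<q =
  subst (ℚ._< p ℚ.* q) (ℚ.*-zeroʳ p)
        (ℚ.*-monoʳ-<-pos p {{ℚ.positive 0<p}} 0<q)

1/-or-0 : ℚ → ℚ
1/-or-0 p with p ℚ.≟ 0ℚ
... | yes _  = 0ℚ
... | no p≢0 = (ℚ.1/ p) {{ℚ.≢-nonZero p≢0}}

1/-or-0-inverse : ∀ {p} → 0ℚ ℚ.< p → 1/-or-0 p ℚ.* p ≡ 1ℚ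
1/-or-0-inverse {p} 0<p with p ℚ.≟ 0ℚ
... | yes p≡0 = ⊥-elim (ℚ.<-irrefl (sym p≡0) 0<p)
... | no p≢0  = ℚ.*-inverseˡ p {{ℚ.≢-nonZero p≢0}}

0<1/-or-0 : ∀ {p} → 0ℚ ℚ.< p → 0ℚ ℚ.< 1/-or-0 p
0<1/-or-0 {p} 0<p =
  ℚ.*-cancelʳ-<-nonNeg p {{ℚ.nonNegative (ℚ.<⇒≤ 0<p)}}
    (subst₂ ℚ._<_ (sym (ℚ.*-zeroˡ p)) (sym (1/-or-0-inverse 0<p))
            (ℚ.positive⁻¹ 1ℚ))

ratio-< : ∀ a b i j → a ℕ.* suc j ℕ.< b ℕ.* suc i →
          + a ℚ./ suc i ℚ.< + b ℚ./ suc j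
ratio-< a b i j lt = ℚ.toℚᵘ-cancel-<
  (ℚᵘ.<-respˡ-≃ (ℚᵘ.≃-sym (ℚ.toℚᵘ-fromℚᵘ (ℚᵘ.mkℚᵘ (+ a) i)))
  (ℚᵘ.<-respʳ-≃ (ℚᵘ.≃-sym (ℚ.toℚᵘ-fromℚᵘ (ℚᵘ.mkℚᵘ (+ b) j)))
  (ℚᵘ.*<* (subst₂ ℤ._<_ (ℤ.pos-* a (suc j)) (ℤ.pos-* b (suc i))
                  (ℤ.+<+ lt)))))

ratio-≤ : ∀ a b i j → a ℕ.* suc j ℕ.≤ b ℕ.* suc i →
          + a ℚ./ suc i ℚ.≤ + b ℚ./ suc j
ratio-≤ a b i j le = ℚ.toℚᵘ-cancel-≤
  (ℚᵘ.≤-respˡ-≃ (ℚᵘ.≃-sym (ℚ.toℚᵘ-fromℚᵘ (ℚᵘ.mkℚᵘ (+ a) i)))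
  (ℚᵘ.≤-respʳ-≃ (ℚᵘ.≃-sym (ℚ.toℚᵘ-fromℚᵘ (ℚᵘ.mkℚᵘ (+ b) j)))
  (ℚᵘ.*≤* (subst₂ ℤ._≤_ (ℤ.pos-* a (suc j)) (ℤ.pos-* b (suc i))
                  (ℤ.+≤+ le)))))

ratio-suc : ∀ a j → + suc a ℚ./ suc j ≡ + a ℚ./ suc j ℚ.+ + 1 ℚ./ suc j
ratio-suc a j = ℚ.toℚᵘ-injective (begin
  ℚ.toℚᵘ (+ suc a ℚ./ suc j)
    ≈⟨ ℚ.toℚᵘ-fromℚᵘ (ℚᵘ.mkℚᵘ (+ suc a) j) ⟩
  ℚᵘ.mkℚᵘ (+ suc a) j
    ≈⟨ ℚᵘ.*≡* (trans (sym (ℤ.pos-* (suc a) (suc j ℕ.* suc j)))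
         (trans (cong +_ (ℕ-eq a (suc j)))
         (trans (ℤ.pos-* (a ℕ.* suc j ℕ.+ 1 ℕ.* suc j) (suc j))
                (cong (ℤ._* + suc j)
                  (trans (ℤ.pos-+ (a ℕ.* suc j) (1 ℕ.* suc j))
                         (cong₂ ℤ._+_ (ℤ.pos-* a (suc j))
                                      (ℤ.pos-* 1 (suc j)))))))) ⟩
  ℚᵘ.mkℚᵘ (+ a) j ℚᵘ.+ ℚᵘ.mkℚᵘ (+ 1) j
    ≈⟨ ℚᵘ.≃-sym (ℚᵘ.+-cong (ℚ.toℚᵘ-fromℚᵘ (ℚᵘ.mkℚᵘ (+ a) j))
                           (ℚ.toℚᵘ-fromℚᵘ (ℚᵘ.mkℚᵘ (+ 1) j))) ⟩
  ℚ.toℚᵘ (+ a ℚ./ suc j) ℚᵘ.+ ℚ.toℚᵘ (+ 1 ℚ./ suc j)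
    ≈⟨ ℚᵘ.≃-sym (ℚ.toℚᵘ-homo-+ (+ a ℚ./ suc j) (+ 1 ℚ./ suc j)) ⟩
  ℚ.toℚᵘ (+ a ℚ./ suc j ℚ.+ + 1 ℚ./ suc j) ∎)
  where
  open ℚᵘ.≃-Reasoning
  ℕ-eq : ∀ a s → suc a ℕ.* (s ℕ.* s) ≡ (a ℕ.* s ℕ.+ 1 ℕ.* s) ℕ.* s
  ℕ-eq = ℕSolver.solve-∀

archimedean : ∀ {ε} → 0ℚ ℚ.< ε → ∃[ N ] + 1 ℚ./ suc N ℚ.< ε
archimedean {mkℚ (+ zero) q c} (ℚ.*<* (ℤ.+<+ ()))
archimedean {mkℚ -[1+ p ] q c} (ℚ.*<* ())
archimedean {ε@(mkℚ (+ suc p) q c)} 0<ε =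
  suc q ,
  subst (+ 1 ℚ./ suc (suc q) ℚ.<_) (ℚ.↥p/↧p≡p ε)
    (ratio-< 1 (suc p) (suc q) q
      (subst (ℕ._≤ suc p ℕ.* suc (suc q))
             (cong suc (sym (ℕ.*-identityˡ (suc q))))
             (ℕ.m≤m+n (suc (suc q)) (p ℕ.* suc (suc q)))))

-- Real numbers are Cauchy sequences of rationals, with no quotient taken.
Cauchy : (ℕ → ℚ) → Set
Cauchy x = ∀ {ε} → 0ℚ ℚ.< ε →
  ∃[ N ] (∀ {i j} → N ℕ.≤ i → N ℕ.≤ j → ℚ.∣ x i ℚ.- x j ∣ ℚ.< ε)

record ℝ : Set where
  constructor mkℝ
  field
    seq    : ℕ → ℚ
    cauchy : Cauchy seq

open ℝ public

infix  4 _≤_ _<_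
infixl 6 _+_ _-_
infixl 7 _*_ _÷_[_]

_≤_ : ℝ → ℝ → Set
x ≤ y = ∀ {ε} → 0ℚ ℚ.< ε →
  ∃[ N ] (∀ {i} → N ℕ.≤ i → seq x i ℚ.≤ seq y i ℚ.+ ε)

_<_ : ℝ → ℝ → Set
x < y = ∃[ ε ] 0ℚ ℚ.< ε ×
  ∃[ N ] (∀ {i} → N ℕ.≤ i → seq x i ℚ.+ ε ℚ.≤ seq y i)

fromℚ : ℚ → ℝ
fromℚ q = mkℝ (λ _ → q) λ 0<ε →
  0 , λ _ _ → subst (ℚ._< _) (sym (dist-refl q)) 0<ε

fromℕ : ℕ → ℝ
fromℕ n = fromℚ (+ n ℚ./ 1)

0ℝ 1ℝ : ℝ
0ℝ = fromℕ 0
1ℝ = fromℕ 1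

_+_ : ℝ → ℝ → ℝ
x + y = mkℝ (λ i → seq x i ℚ.+ seq y i) λ {ε} 0<ε →
  let (M , hx) = cauchy x (0<½* 0<ε)
      (N , hy) = cauchy y (0<½* 0<ε)
  in M ℕ.⊔ N , λ {i} {j} i≥ j≥ →
    ℚ.≤-<-trans
      (subst (ℚ._≤ ℚ.∣ seq x i ℚ.- seq x j ∣ ℚ.+ ℚ.∣ seq y i ℚ.- seq y j ∣)
        (cong ℚ.∣_∣ (rearrange (seq x i) (seq x j) (seq y i) (seq y j)))
        (ℚ.∣p+q∣≤∣p∣+∣q∣ (seq x i ℚ.- seq x j) (seq y i ℚ.- seq y j)))
      (subst (ℚ.∣ seq x i ℚ.- seq x j ∣ ℚ.+ ℚ.∣ seq y i ℚ.- seq y j ∣ ℚ.<_)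
        (½*+½* ε)
        (ℚ.+-mono-<
          (hx (ℕ.m⊔n≤o⇒m≤o M N i≥) (ℕ.m⊔n≤o⇒m≤o M N j≥))
          (hy (ℕ.m⊔n≤o⇒n≤o M N i≥) (ℕ.m⊔n≤o⇒n≤o M N j≥))))
  where
  open ℚSolver.+-*-Solver
  rearrange : ∀ a b c d →
    (a ℚ.- b) ℚ.+ (c ℚ.- d) ≡ (a ℚ.+ c) ℚ.- (b ℚ.+ d)
  rearrange = solve 4 (λ a b c d →
    (a :- b) :+ (c :- d) := (a :+ c) :- (b :+ d)) refl

-_ : ℝ → ℝ
- x = mkℝ (λ i → ℚ.- seq x i) λ 0<ε →
  let (N , h) = cauchy x 0<ε
  in N , λ {i} {j} i≥ j≥ → subst (ℚ._< _)
    (trans (sym (ℚ.∣-p∣≡∣p∣ (seq x i ℚ.- seq x j)))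
           (cong ℚ.∣_∣ (ℚ.neg-distrib-+ (seq x i) (ℚ.- seq x j))))
    (h i≥ j≥)

_-_ : ℝ → ℝ → ℝ
x - y = x + (- y)

bounded : ∀ x → ∃[ B ] 0ℚ ℚ.< B ×
          ∃[ N ] (∀ {i} → N ℕ.≤ i → ℚ.∣ seq x i ∣ ℚ.≤ B)
bounded x =
  let (N , h) = cauchy x (ℚ.positive⁻¹ 1ℚ)
      b       = ℚ.∣ seq x N ∣
  in b ℚ.+ 1ℚ
   , ℚ.+-mono-≤-< (ℚ.0≤∣p∣ (seq x N)) (ℚ.positive⁻¹ 1ℚ)
   , N
   , λ {i} i≥ → ℚ.≤-trans
       (subst (ℚ._≤ b ℚ.+ ℚ.∣ seq x i ℚ.- seq x N ∣)
         (cong ℚ.∣_∣ (cancel (seq x N) (seq x i)))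
         (ℚ.∣p+q∣≤∣p∣+∣q∣ (seq x N) (seq x i ℚ.- seq x N)))
       (ℚ.+-monoʳ-≤ b (ℚ.<⇒≤ (h i≥ ℕ.≤-refl)))
  where
  open ℚSolver.+-*-Solver
  cancel : ∀ a b → a ℚ.+ (b ℚ.- a) ≡ b
  cancel = solve 2 (λ a b → a :+ (b :- a) := b) refl

∣*∣-< : ∀ {p q B δ} → 0ℚ ℚ.< B → ℚ.∣ p ∣ ℚ.≤ B → ℚ.∣ q ∣ ℚ.< δ →
        ℚ.∣ p ℚ.* q ∣ ℚ.< B ℚ.* δ
∣*∣-< {p} {q} {B} 0<B p≤B q<δ =
  subst (ℚ._< _) (sym (ℚ.∣p*q∣≡∣p∣*∣q∣ p q))
    (ℚ.≤-<-trans
      (ℚ.*-monoʳ-≤-nonNeg ℚ.∣ q ∣ {{ℚ.∣-∣-nonNeg q}} p≤B)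
      (ℚ.*-monoʳ-<-pos B {{ℚ.positive 0<B}} q<δ))

_*_ : ℝ → ℝ → ℝ
x * y = mkℝ (λ i → seq x i ℚ.* seq y i) λ {ε} 0<ε →
  let (A , 0<A , K , hA) = bounded x
      (B , 0<B , L , hB) = bounded y
      (M , hx) = cauchy x (0<* (0<1/-or-0 0<B) (0<½* 0<ε))
      (N , hy) = cauchy y (0<* (0<1/-or-0 0<A) (0<½* 0<ε))
  in (K ℕ.⊔ L) ℕ.⊔ (M ℕ.⊔ N) , λ {i} {j} i≥ j≥ →
    let KL≤ : ∀ {n} → (K ℕ.⊔ L) ℕ.⊔ (M ℕ.⊔ N) ℕ.≤ n → K ℕ.⊔ L ℕ.≤ n
        KL≤ = ℕ.m⊔n≤o⇒m≤o (K ℕ.⊔ L) (M ℕ.⊔ N)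
        MN≤ : ∀ {n} → (K ℕ.⊔ L) ℕ.⊔ (M ℕ.⊔ N) ℕ.≤ n → M ℕ.⊔ N ℕ.≤ n
        MN≤ = ℕ.m⊔n≤o⇒n≤o (K ℕ.⊔ L) (M ℕ.⊔ N)
        xi = seq x i ; xj = seq x j ; yi = seq y i ; yj = seq y j
    in ℚ.≤-<-trans
      (subst (ℚ._≤ ℚ.∣ xi ℚ.* (yi ℚ.- yj) ∣ ℚ.+ ℚ.∣ yj ℚ.* (xi ℚ.- xj) ∣)
        (cong ℚ.∣_∣ (rearrange xi xj yi yj))
        (ℚ.∣p+q∣≤∣p∣+∣q∣ (xi ℚ.* (yi ℚ.- yj)) (yj ℚ.* (xi ℚ.- xj))))
      (subst (ℚ.∣ xi ℚ.* (yi ℚ.- yj) ∣ ℚ.+ ℚ.∣ yj ℚ.* (xi ℚ.- xj) ∣ ℚ.<_)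
        (trans (cong₂ ℚ._+_ (cancel 0<A (½ ℚ.* ε)) (cancel 0<B (½ ℚ.* ε)))
               (½*+½* ε))
        (ℚ.+-mono-<
          (∣*∣-< {p = xi} {q = yi ℚ.- yj} 0<A
            (hA (ℕ.m⊔n≤o⇒m≤o K L (KL≤ i≥)))
            (hy (ℕ.m⊔n≤o⇒n≤o M N (MN≤ i≥)) (ℕ.m⊔n≤o⇒n≤o M N (MN≤ j≥))))
          (∣*∣-< {p = yj} {q = xi ℚ.- xj} 0<B
            (hB (ℕ.m⊔n≤o⇒n≤o K L (KL≤ j≥)))
            (hx (ℕ.m⊔n≤o⇒m≤o M N (MN≤ i≥)) (ℕ.m⊔n≤o⇒m≤o M N (MN≤ j≥))))))
  where
  open ℚSolver.+-*-Solver
  rearrange : ∀ a b c d →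
    a ℚ.* (c ℚ.- d) ℚ.+ d ℚ.* (a ℚ.- b) ≡ a ℚ.* c ℚ.- b ℚ.* d
  rearrange = solve 4 (λ a b c d →
    a :* (c :- d) :+ d :* (a :- b) := a :* c :- b :* d) refl
  cancel : ∀ {A} → 0ℚ ℚ.< A → ∀ q → A ℚ.* (1/-or-0 A ℚ.* q) ≡ q
  cancel {A} 0<A q =
    trans (sym (ℚ.*-assoc A (1/-or-0 A) q))
    (trans (cong (ℚ._* q) (trans (ℚ.*-comm A (1/-or-0 A)) (1/-or-0-inverse 0<A)))
           (ℚ.*-identityˡ q))

-- A positive real may have finitely many zero terms in its sequence;
-- these are inverted to 0.
recip : (y : ℝ) → 0ℝ < y → ℝ
recip y (e , 0<e , M , e≤y) = mkℝ (λ i → 1/-or-0 (seq y i)) λ {ε} 0<ε →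
  let (N , hy) = cauchy y (0<* 0<ε (0<* 0<e 0<e))
  in M ℕ.⊔ N , λ {i} {j} i≥ j≥ →
    let e≤ : ∀ {n} → M ℕ.⊔ N ℕ.≤ n → e ℚ.≤ seq y n
        e≤ {n} n≥ = subst (ℚ._≤ seq y n) (ℚ.+-identityˡ e)
                          (e≤y (ℕ.m⊔n≤o⇒m≤o M N n≥))
    in close (e≤ i≥) (e≤ j≥) 0<ε
         (hy (ℕ.m⊔n≤o⇒n≤o M N j≥) (ℕ.m⊔n≤o⇒n≤o M N i≥))
  where
  open ℚSolver.+-*-Solver
  rearrange : ∀ a b p q →
    (a ℚ.- b) ℚ.* (p ℚ.* q) ≡ (a ℚ.* p) ℚ.* q ℚ.- (b ℚ.* q) ℚ.* p
  rearrange = solve 4 (λ a b p q →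
    (a :- b) :* (p :* q) := (a :* p) :* q :- (b :* q) :* p) refl

  close : ∀ {p q ε} → e ℚ.≤ p → e ℚ.≤ q → 0ℚ ℚ.< ε →
          ℚ.∣ q ℚ.- p ∣ ℚ.< ε ℚ.* (e ℚ.* e) →
          ℚ.∣ 1/-or-0 p ℚ.- 1/-or-0 q ∣ ℚ.< ε
  close {p} {q} {ε} e≤p e≤q 0<ε q-p< =
    ℚ.*-cancelʳ-<-nonNeg (p ℚ.* q) {{ℚ.nonNegative (ℚ.<⇒≤ (0<* 0<p 0<q))}}
      (subst (ℚ._< ε ℚ.* (p ℚ.* q)) (sym scaled)
        (ℚ.<-≤-trans q-p<
          (ℚ.*-monoˡ-≤-nonNeg ε {{ℚ.nonNegative (ℚ.<⇒≤ 0<ε)}}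
            (ℚ.≤-trans
              (ℚ.*-monoˡ-≤-nonNeg e {{ℚ.nonNegative (ℚ.<⇒≤ 0<e)}} e≤q)
              (ℚ.*-monoʳ-≤-nonNeg q {{ℚ.nonNegative (ℚ.<⇒≤ 0<q)}} e≤p)))))
    where
    0<p : 0ℚ ℚ.< p
    0<p = ℚ.<-≤-trans 0<e e≤p
    0<q : 0ℚ ℚ.< q
    0<q = ℚ.<-≤-trans 0<e e≤q
    scaled : ℚ.∣ 1/-or-0 p ℚ.- 1/-or-0 q ∣ ℚ.* (p ℚ.* q) ≡ ℚ.∣ q ℚ.- p ∣
    scaled =
      trans (cong (ℚ.∣ 1/-or-0 p ℚ.- 1/-or-0 q ∣ ℚ.*_)
                  (sym (ℚ.0≤p⇒∣p∣≡p (ℚ.<⇒≤ (0<* 0<p 0<q)))))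
      (trans (sym (ℚ.∣p*q∣≡∣p∣*∣q∣ (1/-or-0 p ℚ.- 1/-or-0 q) (p ℚ.* q)))
      (cong ℚ.∣_∣
        (trans (rearrange (1/-or-0 p) (1/-or-0 q) p q)
               (cong₂ ℚ._-_
                 (trans (cong (ℚ._* q) (1/-or-0-inverse 0<p)) (ℚ.*-identityˡ q))
                 (trans (cong (ℚ._* p) (1/-or-0-inverse 0<q))
                        (ℚ.*-identityˡ p))))))

_÷_[_] : ℝ → (y : ℝ) → 0ℝ < y → ℝ
x ÷ y [ 0<y ] = x * recip y 0<y

2^⌊log₂⌋≤ : ∀ n .{{_ : ℕ.NonZero n}} → 2 ℕ.^ ⌊log₂ n ⌋ ℕ.≤ n
2^⌊log₂⌋≤ n = go n (<-wellFounded n)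
  where
  2*⌊/2⌋≤ : ∀ n → 2 ℕ.* ⌊ n /2⌋ ℕ.≤ n
  2*⌊/2⌋≤ zero          = z≤n
  2*⌊/2⌋≤ (suc zero)    = z≤n
  2*⌊/2⌋≤ (suc (suc n)) =
    subst (ℕ._≤ suc (suc n)) (sym (ℕ.*-suc 2 ⌊ n /2⌋))
          (s≤s (s≤s (2*⌊/2⌋≤ n)))
  go : ∀ n .{{_ : ℕ.NonZero n}} (a : Acc ℕ._<_ n) → 2 ℕ.^ ⌊log2⌋ n a ℕ.≤ n
  go (suc zero)    _        = ℕ.≤-refl
  go (suc (suc n)) (acc rs) = ℕ.≤-trans
    (ℕ.*-monoʳ-≤ 2 (go (suc ⌊ n /2⌋) (rs _)))
    (2*⌊/2⌋≤ (suc (suc n)))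

<2^suc⌊log₂⌋ : ∀ n → n ℕ.< 2 ℕ.^ suc ⌊log₂ n ⌋
<2^suc⌊log₂⌋ n with ℕ.<-≤-connex n (2 ℕ.^ suc ⌊log₂ n ⌋)
... | inj₁ lt = lt
... | inj₂ le = ⊥-elim (ℕ.<-irrefl refl
  (subst (ℕ._≤ ⌊log₂ n ⌋) (⌊log₂[2^n]⌋≡n (suc ⌊log₂ n ⌋)) (⌊log₂⌋-mono-≤ le)))

2^-cancel-< : ∀ {a b} → 2 ℕ.^ a ℕ.< 2 ℕ.^ b → a ℕ.< b
2^-cancel-< {a} {b} lt with ℕ.<-≤-connex a b
... | inj₁ a<b = a<b
... | inj₂ b≤a = ⊥-elim (ℕ.<⇒≱ lt (ℕ.^-monoʳ-≤ 2 b≤a))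

2^-cancel-≤ : ∀ {a b} → 2 ℕ.^ a ℕ.≤ 2 ℕ.^ b → a ℕ.≤ b
2^-cancel-≤ {a} {b} le with ℕ.<-≤-connex b a
... | inj₂ a≤b = a≤b
... | inj₁ b<a =
  ⊥-elim (ℕ.<⇒≱ (ℕ.^-monoʳ-< 2 (s≤s (s≤s z≤n)) b<a) le)

^-swap : ∀ n a b → (n ℕ.^ a) ℕ.^ b ≡ (n ℕ.^ b) ℕ.^ a
^-swap n a b = trans (ℕ.^-*-assoc n a b)
  (trans (cong (n ℕ.^_) (ℕ.*-comm a b)) (sym (ℕ.^-*-assoc n b a)))

cross-< : ∀ a b n i j → 2 ℕ.^ a ℕ.≤ n ℕ.^ suc i → n ℕ.^ suc j ℕ.< 2 ℕ.^ b →
          a ℕ.* suc j ℕ.< b ℕ.* suc i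
cross-< a b n i j le lt = 2^-cancel-< (begin-strict
  2 ℕ.^ (a ℕ.* suc j)        ≡⟨ sym (ℕ.^-*-assoc 2 a (suc j)) ⟩
  (2 ℕ.^ a) ℕ.^ suc j        ≤⟨ ℕ.^-monoˡ-≤ (suc j) le ⟩
  (n ℕ.^ suc i) ℕ.^ suc j    ≡⟨ ^-swap n (suc i) (suc j) ⟩
  (n ℕ.^ suc j) ℕ.^ suc i    <⟨ ℕ.^-monoˡ-< (suc i) lt ⟩
  (2 ℕ.^ b) ℕ.^ suc i        ≡⟨ ℕ.^-*-assoc 2 b (suc i) ⟩
  2 ℕ.^ (b ℕ.* suc i)        ∎)
  where open ℕ.≤-Reasoning

cross-≤ : ∀ a b n i j → 2 ℕ.^ a ℕ.≤ n ℕ.^ suc i → n ℕ.^ suc j ℕ.≤ 2 ℕ.^ b →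
          a ℕ.* suc j ℕ.≤ b ℕ.* suc i
cross-≤ a b n i j le le′ = 2^-cancel-≤ (begin
  2 ℕ.^ (a ℕ.* suc j)        ≡⟨ sym (ℕ.^-*-assoc 2 a (suc j)) ⟩
  (2 ℕ.^ a) ℕ.^ suc j        ≤⟨ ℕ.^-monoˡ-≤ (suc j) le ⟩
  (n ℕ.^ suc i) ℕ.^ suc j    ≡⟨ ^-swap n (suc i) (suc j) ⟩
  (n ℕ.^ suc j) ℕ.^ suc i    ≤⟨ ℕ.^-monoˡ-≤ (suc i) le′ ⟩
  (2 ℕ.^ b) ℕ.^ suc i        ≡⟨ ℕ.^-*-assoc 2 b (suc i) ⟩
  2 ℕ.^ (b ℕ.* suc i)        ∎)
  where open ℕ.≤-Reasoning

2^⌊log₂^⌋≤ : ∀ n .{{_ : ℕ.NonZero n}} i →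
             2 ℕ.^ ⌊log₂ n ℕ.^ suc i ⌋ ℕ.≤ n ℕ.^ suc i
2^⌊log₂^⌋≤ n i = 2^⌊log₂⌋≤ (n ℕ.^ suc i) {{ℕ.m^n≢0 n (suc i)}}

-- log₂ n lies between k / i and (k + 1) / i for k = ⌊log₂ (n ^ i)⌋.
log₂-approx : ℕ → ℕ → ℚ
log₂-approx n i = + ⌊log₂ n ℕ.^ suc i ⌋ ℚ./ suc i

below-approx : ∀ a n i j → 2 ℕ.^ a ℕ.≤ n ℕ.^ suc i →
  + a ℚ./ suc i ℚ.< log₂-approx n j ℚ.+ + 1 ℚ./ suc j
below-approx a n i j le =
  subst (+ a ℚ./ suc i ℚ.<_) (ratio-suc ⌊log₂ n ℕ.^ suc j ⌋ j)
    (ratio-< a (suc ⌊log₂ n ℕ.^ suc j ⌋) i j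
      (cross-< a (suc ⌊log₂ n ℕ.^ suc j ⌋) n i j le
               (<2^suc⌊log₂⌋ (n ℕ.^ suc j))))

1/-antitone : ∀ {N i} → N ℕ.≤ i → + 1 ℚ./ suc i ℚ.≤ + 1 ℚ./ suc N
1/-antitone {N} {i} N≤i = ratio-≤ 1 1 i N (ℕ.*-monoʳ-≤ 1 (s≤s N≤i))

<+⇒-< : ∀ {p q r} → p ℚ.< q ℚ.+ r → p ℚ.- q ℚ.< r
<+⇒-< {p} {q} {r} lt =
  subst (p ℚ.- q ℚ.<_) (cancel q r) (ℚ.+-monoˡ-< (ℚ.- q) lt)
  where
  open ℚSolver.+-*-Solver
  cancel : ∀ q r → (q ℚ.+ r) ℚ.- q ≡ r
  cancel = solve 2 (λ q r → (q :+ r) :- q := r) refl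

∣-∣-< : ∀ {p q r} → p ℚ.< q ℚ.+ r → q ℚ.< p ℚ.+ r → ℚ.∣ p ℚ.- q ∣ ℚ.< r
∣-∣-< {p} {q} {r} p< q< with ℚ.∣p∣≡p∨∣p∣≡-p (p ℚ.- q)
... | inj₁ eq = subst (ℚ._< r) (sym eq) (<+⇒-< p<)
... | inj₂ eq = subst (ℚ._< r) (sym (trans eq (flip p q))) (<+⇒-< q<)
  where
  open ℚSolver.+-*-Solver
  flip : ∀ p q → ℚ.- (p ℚ.- q) ≡ q ℚ.- p
  flip = solve 2 (λ p q → :- (p :- q) := q :- p) refl

log₂-cauchy : ∀ n .{{_ : ℕ.NonZero n}} → Cauchy (log₂-approx n)
log₂-cauchy n 0<ε =
  let (N , 1/N<ε) = archimedean 0<ε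
      step : ∀ {i j} → N ℕ.≤ j →
             log₂-approx n i ℚ.< log₂-approx n j ℚ.+ + 1 ℚ./ suc N
      step {i} {j} j≥ = ℚ.<-≤-trans
        (below-approx ⌊log₂ n ℕ.^ suc i ⌋ n i j (2^⌊log₂^⌋≤ n i))
        (ℚ.+-monoʳ-≤ (log₂-approx n j) (1/-antitone j≥))
  in N , λ {i} {j} i≥ j≥ →
    ℚ.<-trans (∣-∣-< (step {i} {j} j≥) (step {j} {i} i≥)) 1/N<ε

log₂ : (n : ℕ) .{{_ : ℕ.NonZero n}} → ℝ
log₂ n = mkℝ (log₂-approx n) (log₂-cauchy n)

-- The next two facts determine log₂ n among the reals.

log₂-lower : ∀ n .{{_ : ℕ.NonZero n}} a b →
  2 ℕ.^ a ℕ.≤ n ℕ.^ suc b → fromℚ (+ a ℚ./ suc b) ≤ log₂ n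
log₂-lower n a b le 0<ε =
  let (N , 1/N<ε) = archimedean 0<ε
  in N , λ {i} i≥ → ℚ.<⇒≤ (ℚ.<-≤-trans
       (below-approx a n b i le)
       (ℚ.+-monoʳ-≤ (log₂-approx n i)
         (ℚ.≤-trans (1/-antitone i≥) (ℚ.<⇒≤ 1/N<ε))))

log₂-upper : ∀ n .{{_ : ℕ.NonZero n}} a b →
  n ℕ.^ suc b ℕ.≤ 2 ℕ.^ a → log₂ n ≤ fromℚ (+ a ℚ./ suc b)
log₂-upper n a b le {ε} 0<ε = 0 , λ {i} _ →
  ℚ.≤-trans
    (ratio-≤ ⌊log₂ n ℕ.^ suc i ⌋ a i b
      (cross-≤ ⌊log₂ n ℕ.^ suc i ⌋ a n i b (2^⌊log₂^⌋≤ n i) le))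
    (subst (ℚ._≤ (+ a ℚ./ suc b) ℚ.+ ε) (ℚ.+-identityʳ (+ a ℚ./ suc b))
           (ℚ.+-monoʳ-≤ (+ a ℚ./ suc b) (ℚ.<⇒≤ 0<ε)))

0<log₂+3 : ∀ n .{{_ : ℕ.NonZero n}} → 0ℝ < log₂ n + fromℕ 3
0<log₂+3 n = + 3 ℚ./ 1 , ℚ.positive⁻¹ (+ 3 ℚ./ 1) , 0 , λ {i} _ →
  ℚ.+-monoˡ-≤ (+ 3 ℚ./ 1)
    (ratio-≤ 0 ⌊log₂ n ℕ.^ suc i ⌋ 0 i z≤n)

record WeightedInterval (d : ℕ) : Set where
  field
    left right  : ℝ
    left≤right  : left ≤ right
    weight      : Fin d → ℝ
    0≤weight    : ∀ j → 0ℝ ≤ weight j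
    weight≤1    : ∀ j → weight j ≤ 1ℝ

open WeightedInterval public

_∈ᴵ_ : ∀ {d} → ℝ → WeightedInterval d → Set
p ∈ᴵ I = left I ≤ p × p ≤ right I

∑[_] : ∀ {n} → Subset n → (Fin n → ℝ) → ℝ
∑[ S ] f = Vector.foldr _+_ 0ℝ (λ i → if lookup S i then f i else 0ℝ)

Color : Set
Color = ℕ

-- The order on ℝ is not decidable, so the set of intervals that contain p
-- and have color γ is not computed: it enters as the subset S of indices
-- with exactly those members.
IsColoring : ∀ {d n} → ℕ → Vec (WeightedInterval d) n → Vec Color n → Set
IsColoring {d} {n} k Is cs =
  ∀ (γ : Color) (p : ℝ) (S : Subset n) →
  (∀ i → i ∈ S ⇔ (p ∈ᴵ lookup Is i × lookup cs i ≡ γ)) →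
  ∣ S ∣ ℕ.≤ k ×
  (∀ (j : Fin d) → ∑[ S ] (λ i → weight (lookup Is i) j) ≤ 1ℝ)

#colors : ∀ {n} → Vec Color n → ℕ
#colors cs = length (deduplicate ℕ._≟_ (toList cs))

Colorable : ∀ {d n} → ℕ → ℝ → Vec (WeightedInterval d) n → Set
Colorable {n = n} k x Is =
  ∃[ cs ] IsColoring k Is cs × fromℕ (#colors {n} cs) ≤ x

-- A strategy for Presenter: after each round the continuation may depend on
-- the color just chosen. Well-foundedness makes every play finite.
data Strategy (d : ℕ) : Set where
  stop    : Strategy d
  present : WeightedInterval d → (Color → Strategy d) → Strategy d

-- Is and cs record the intervals presented so far and Algorithm's colors,
-- latest first.
ForcesFrom : ∀ {d n} → ℕ → (c x : ℝ) →
             Vec (WeightedInterval d) n → Vec Color n → Strategy d → Set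
ForcesFrom k c x Is cs stop =
  c ≤ fromℕ (#colors cs) × Colorable k x Is
ForcesFrom k c x Is cs (present I σ) =
  ∀ γ → IsColoring k (I ∷ Is) (γ ∷ cs) →
  ForcesFrom k c x (I ∷ Is) (γ ∷ cs) (σ γ)

Forces : ∀ {d} → ℕ → (c x : ℝ) → Strategy d → Set
Forces k c x σ = ForcesFrom k c x [] [] σ

{-# OPTIONS --safe #-}

-- A layer consists of at most d intervals with common endpoints, presented as in the
-- lower bound of Halldórsson and Szegedy for on-line graph coloring. There are
-- h = ⌊log d⌋ + 3 hues. A new interval comes with a set A of ⌊h/2⌋ hues that is not the
-- set of hues of any color used so far (there is one, unless the number of colors has
-- already reached (h choose ⌊h/2⌋) ≥ 2d/h), and it clashes with the earlier intervals of
-- hue outside A; once it is colored, it receives a hue of A that its color does not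
-- have yet. So a color has distinct hues, at most h/2 of them, and Algorithm uses at
-- least 2d/h colors, whereas intervals of one hue do not clash and all of them can be
-- colored with h + d/k colors. Layers whose weights are of different scales clash
-- completely wherever they overlap.
--
-- A tower of level 0 is a layer. For level m + 1, build so many disjoint towers of
-- level m that four of them, P₁, …, P₄ from left to right, have the same set of colors.
-- Cover P₁ by a layer A and P₄ by a layer D. If A and D together use at least 3d/h
-- colors, a single layer over P₂ and P₃ that touches both adds 2d/h more. Otherwise a
-- layer B over P₂ touching A and a layer G over P₃ touching B and D have, together with
-- D, at least 5d/h colors. Each level thus costs Algorithm 5d/h new colors. Offline it
-- costs one new palette of h + d/k colors: along the line, the new layers take the new
-- palette and the lowest one in turn, and below a layer with the lowest palette every
-- palette is raised by one.

module Submission where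

module Forcing where

  open import Data.Bool.Base using (true; false; if_then_else_)
  open import Data.Empty as Empty using (⊥-elim)
  open import Data.Fin.Base using (Fin; zero; suc; toℕ; fromℕ<)
  open import Data.Fin.Properties using (any?; toℕ-fromℕ<; toℕ<n; toℕ-injective) renaming (_≟_ to _≟ᶠ_)
  open import Data.Fin.Subset as Subset using (Subset; inside; outside; ⊥; _∪_; ⁅_⁆; ∣_∣)
    renaming (_∈_ to _∈ˢ_; _∉_ to _∉ˢ_; _⊆_ to _⊆ˢ_)
  open import Data.Fin.Subset.Properties
    using (∣⊥∣≡0; ∉⊥; ⊆-antisym; x∈p∪q⁻; x∈p∪q⁺; x∈⁅x⁆; x∈⁅y⁆⇒x≡y; p⊆q⇒∣p∣≤∣q∣; p⊂q⇒∣p∣<∣q∣)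
    renaming (_∈?_ to _∈ˢ?_)
  import Data.Integer.Base as ℤ
  open import Data.List.Base hiding (sum; _∷ʳ_; lookup; find)
  open import Data.List.Membership.Propositional
  open import Data.List.Membership.Propositional.Properties
  open import Data.List.Properties
  open import Data.List.Relation.Binary.Sublist.Propositional as Sublist using ([]; _∷_; _∷ʳ_)
    renaming (_⊆_ to _⊑_)
  open import Data.List.Relation.Binary.Sublist.Propositional.Properties
    using (filter⁺; filter-⊆; length-mono-≤)
  open import Data.List.Relation.Binary.Subset.Propositional using (_⊆_)
  open import Data.List.Relation.Unary.All as All using (All; []; _∷_)
  open import Data.List.Relation.Unary.AllPairs using (AllPairs; []; _∷_)
  import Data.List.Relation.Unary.AllPairs.Properties as AllPairs
  open import Data.List.Relation.Unary.Any as Any using (here; there)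
  open import Data.List.Relation.Unary.Unique.Propositional using (Unique)
  import Data.List.Relation.Unary.Unique.Propositional.Properties as Unique
  open import Data.Nat.Base
  open import Data.Nat.Combinatorics using (_C_; k>n⇒nCk≡0; nC1≡n; nCk≡nC[n∸k]; nCk+nC[k+1]≡[n+1]C[k+1])
  open import Data.Nat.DivMod using (m≡m%n+[m/n]*n; m%n<n; m/n*n≤m; /-monoˡ-≤)
  open import Data.Nat.ListAction using (sum)
  open import Data.Nat.Logarithm using (⌊log₂_⌋; ⌊log₂⌋-mono-≤; ⌊log₂[2^n]⌋≡n)
  open import Data.Nat.Properties
  import Data.Nat.Tactic.RingSolver as ℕSolver
  open import Data.Product.Base using (_×_; _,_; proj₁; proj₂; ∃-syntax; map₂)
  open import Data.Rational.Base as ℚ using (ℚ; 0ℚ; 1ℚ; ½)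
  import Data.Rational.Properties as ℚ
  import Data.Rational.Solver as ℚSolver
  open import Data.Sum.Base using (_⊎_; inj₁; inj₂; [_,_]′)
  open import Data.Vec.Base as Vec using (Vec; []; _∷_; lookup; toList; here; there)
  open import Data.Vec.Properties using ([]=⇒lookup; lookup⇒[]=)
  open import Function.Base
  open import Function.Bundles using (_⇔_; mk⇔; Equivalence)
  open import Relation.Binary.Definitions using (tri<; tri≈; tri>)
  open import Relation.Binary.PropositionalEquality
  open import Relation.Nullary
  open import Relation.Nullary.Decidable
    using (_×-dec_; _⊎-dec_; _→-dec_; dec-true; dec-false; decidable-stable)
  open import Data.List.Membership.DecPropositional _≟_ using (_∈?_)
  open import Data.List.Relation.Unary.Unique.DecPropositional.Properties _≟_ using (deduplicate-!)
  import Defs as D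
  open D using (ℝ; seq; fromℚ; fromℕ)

  private variable
    A : Set

  -- Counting the colors in a list

  length-filter-split : ∀ {P : A → Set} (P? : ∀ x → Dec (P x)) xs →
    length xs ≡ length (filter P? xs) + length (filter (¬? ∘ P?) xs)
  length-filter-split P? [] = refl
  length-filter-split P? (x ∷ xs) with P? x
  ... | yes _ = cong suc (length-filter-split P? xs)
  ... | no  _ = trans (cong suc (length-filter-split P? xs)) (sym (+-suc _ _))

  unique-length-≤ : ∀ {xs ys : List A} → Unique xs → xs ⊆ ys → length xs ≤ length ys
  unique-length-≤ [] _ = z≤n
  unique-length-≤ {xs = x ∷ xs} (x∉ ∷ u) xs⊆ with ∈-∃++ (xs⊆ (here refl))
  ... | us , vs , refl = subst (suc (length xs) ≤_) eq (s≤s (unique-length-≤ u kept))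
    where
    kept : xs ⊆ us ++ vs
    kept {z} z∈ with ∈-++⁻ us (xs⊆ (there z∈))
    ... | inj₁ p           = ∈-++⁺ˡ p
    ... | inj₂ (here z≡x)  = ⊥-elim (All.lookup x∉ z∈ (sym z≡x))
    ... | inj₂ (there p)   = ∈-++⁺ʳ us p
    eq : suc (length (us ++ vs)) ≡ length (us ++ x ∷ vs)
    eq = trans (cong suc (length-++ us)) (trans (sym (+-suc _ _)) (sym (length-++ us)))

  distinct : List ℕ → ℕ
  distinct xs = length (deduplicate _≟_ xs)

  distinct-≤ : ∀ {xs ys} → xs ⊆ ys → distinct xs ≤ length ys
  distinct-≤ {xs} xs⊆ = unique-length-≤ (deduplicate-! xs) (xs⊆ ∘ ∈-deduplicate⁻ _≟_ xs)

  distinct-mono : ∀ {xs ys} → xs ⊆ ys → distinct xs ≤ distinct ys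
  distinct-mono xs⊆ = distinct-≤ (∈-deduplicate⁺ _≟_ ∘ xs⊆)

  distinct-<-bound : ∀ {n xs} → All (_< n) xs → distinct xs ≤ n
  distinct-<-bound {n} {xs} all< = subst (distinct xs ≤_) (length-upTo n)
    (distinct-≤ (λ x∈ → ∈-upTo⁺ (All.lookup all< x∈)))

  Disjoint : List ℕ → List ℕ → Set
  Disjoint xs ys = ∀ {z} → z ∈ xs → ¬ z ∈ ys

  distinct-++-disjoint : ∀ {xs ys} → Disjoint xs ys → distinct xs + distinct ys ≤ distinct (xs ++ ys)
  distinct-++-disjoint {xs} {ys} dis = subst (_≤ distinct (xs ++ ys)) (length-++ (deduplicate _≟_ xs))
    (unique-length-≤
      (Unique.++⁺ (deduplicate-! xs) (deduplicate-! ys)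
        (λ (p , q) → dis (∈-deduplicate⁻ _≟_ xs p) (∈-deduplicate⁻ _≟_ ys q)))
      (λ z∈ → ∈-deduplicate⁺ _≟_ (case ∈-++⁻ (deduplicate _≟_ xs) z∈ of λ where
        (inj₁ p) → ∈-++⁺ˡ (∈-deduplicate⁻ _≟_ xs p)
        (inj₂ p) → ∈-++⁺ʳ xs (∈-deduplicate⁻ _≟_ ys p))))

  -- Everything is covered by `xs ++ zs` together with the entries of `ys` outside `zs`, and those
  -- entries are disjoint from `zs` inside `ys ++ zs`.
  distinct-submodular : ∀ xs ys zs →
    distinct (xs ++ ys ++ zs) + distinct zs ≤ distinct (xs ++ zs) + distinct (ys ++ zs)
  distinct-submodular xs ys zs = begin
    distinct (xs ++ ys ++ zs) + distinct zs
      ≤⟨ +-monoˡ-≤ _ (subst (distinct (xs ++ ys ++ zs) ≤_)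
           (length-++ (deduplicate _≟_ (xs ++ zs))) (distinct-≤ cover)) ⟩
    distinct (xs ++ zs) + distinct ys∖ + distinct zs
      ≡⟨ +-assoc (distinct (xs ++ zs)) _ _ ⟩
    distinct (xs ++ zs) + (distinct ys∖ + distinct zs)
      ≤⟨ +-monoʳ-≤ (distinct (xs ++ zs)) (≤-trans
           (distinct-++-disjoint (λ p → proj₂ (∈-filter⁻ (¬? ∘ (_∈? zs)) {xs = ys} p)))
           (distinct-mono sub)) ⟩
    distinct (xs ++ zs) + distinct (ys ++ zs) ∎
    where
    open ≤-Reasoning
    ys∖ = filter (¬? ∘ (_∈? zs)) ys
    sub : ys∖ ++ zs ⊆ ys ++ zs
    sub z∈ with ∈-++⁻ ys∖ z∈
    ... | inj₁ p = ∈-++⁺ˡ (proj₁ (∈-filter⁻ (¬? ∘ (_∈? zs)) {xs = ys} p))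
    ... | inj₂ p = ∈-++⁺ʳ ys p
    cover : xs ++ ys ++ zs ⊆ deduplicate _≟_ (xs ++ zs) ++ deduplicate _≟_ ys∖
    cover {z} z∈ with z ∈? xs ++ zs
    ... | yes p = ∈-++⁺ˡ (∈-deduplicate⁺ _≟_ p)
    ... | no ¬p with ∈-++⁻ xs z∈
    ...   | inj₁ p = ⊥-elim (¬p (∈-++⁺ˡ p))
    ...   | inj₂ q with ∈-++⁻ ys q
    ...     | inj₁ p = ∈-++⁺ʳ _ (∈-deduplicate⁺ _≟_ (∈-filter⁺ (¬? ∘ (_∈? zs)) p (¬p ∘ ∈-++⁺ʳ xs)))
    ...     | inj₂ p = ⊥-elim (¬p (∈-++⁺ʳ xs p))

  -- Induction on `us`: the occurrences of `u` are split off and the rest is covered by the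
  -- remaining `us`. This later turns a bound on how often each color is used into a lower bound on
  -- the number of colors.
  length-≤-multiplicity : ∀ {s} (us xs : List ℕ) → xs ⊆ us →
    (∀ u → length (filter (_≟ u) xs) ≤ s) → length xs ≤ s * length us
  length-≤-multiplicity [] [] _ _ = z≤n
  length-≤-multiplicity [] (x ∷ xs) sub _ with sub (here refl)
  ... | ()
  length-≤-multiplicity {s} (u ∷ us) xs sub mult = begin
    length xs                                   ≡⟨ length-filter-split (_≟ u) xs ⟩
    length (filter (_≟ u) xs) + length rest     ≤⟨ +-mono-≤ (mult u) (length-≤-multiplicity us rest sub′ mult′) ⟩
    s + s * length us                           ≡⟨ *-suc s (length us) ⟨
    s * suc (length us)                         ∎
    where
    open ≤-Reasoning
    rest = filter (¬? ∘ (_≟ u)) xs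
    sub′ : rest ⊆ us
    sub′ z∈ with ∈-filter⁻ (¬? ∘ (_≟ u)) {xs = xs} z∈
    ... | z∈xs , z≢u with sub z∈xs
    ...   | here z≡u = ⊥-elim (z≢u z≡u)
    ...   | there p  = p
    mult′ : ∀ v → length (filter (_≟ v) rest) ≤ s
    mult′ v = ≤-trans (length-mono-≤ (filter⁺ (_≟ v) (_≟ v) (λ { refl p → p })
                (filter-⊆ (¬? ∘ (_≟ u)) xs))) (mult v)

  distinct-multiplicity : ∀ {s} xs → (∀ u → length (filter (_≟ u) xs) ≤ s) → length xs ≤ s * distinct xs
  distinct-multiplicity xs = length-≤-multiplicity (deduplicate _≟_ xs) xs (∈-deduplicate⁺ _≟_)

  -- Subsets of half size

  tailsIn tailsOut : ∀ {n} → List (Subset (suc n)) → List (Subset n)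
  tailsIn []                    = []
  tailsIn ((inside  ∷ A) ∷ L)   = A ∷ tailsIn L
  tailsIn ((outside ∷ _) ∷ L)   = tailsIn L
  tailsOut []                   = []
  tailsOut ((inside  ∷ _) ∷ L)  = tailsOut L
  tailsOut ((outside ∷ A) ∷ L)  = A ∷ tailsOut L

  length-tails : ∀ {n} (L : List (Subset (suc n))) → length (tailsIn L) + length (tailsOut L) ≡ length L
  length-tails []                  = refl
  length-tails ((inside  ∷ _) ∷ L) = cong suc (length-tails L)
  length-tails ((outside ∷ _) ∷ L) = trans (+-suc _ _) (cong suc (length-tails L))

  ∈-tailsIn : ∀ {n A} {L : List (Subset (suc n))} → inside ∷ A ∈ L → A ∈ tailsIn L
  ∈-tailsIn {L = (inside  ∷ _) ∷ _} (here refl) = here refl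
  ∈-tailsIn {L = (inside  ∷ _) ∷ _} (there p)   = there (∈-tailsIn p)
  ∈-tailsIn {L = (outside ∷ _) ∷ _} (there p)   = ∈-tailsIn p

  ∈-tailsOut : ∀ {n A} {L : List (Subset (suc n))} → outside ∷ A ∈ L → A ∈ tailsOut L
  ∈-tailsOut {L = (outside ∷ _) ∷ _} (here refl) = here refl
  ∈-tailsOut {L = (outside ∷ _) ∷ _} (there p)   = there (∈-tailsOut p)
  ∈-tailsOut {L = (inside  ∷ _) ∷ _} (there p)   = ∈-tailsOut p

  -- Follows Pascal's rule: the listed subsets split by whether they contain the first element, and
  -- one of the two parts is too short for its share of the `r`-subsets.
  avoid : ∀ n r (L : List (Subset n)) → length L < n C r → ∃[ A ] ∣ A ∣ ≡ r × ¬ A ∈ L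
  avoid zero    zero    []      _  = [] , refl , λ ()
  avoid zero    zero    (_ ∷ _) (s≤s ())
  avoid zero    (suc r) L       lt = ⊥-elim (n≮0 (subst (length L <_) (k>n⇒nCk≡0 (z<s {r})) lt))
  avoid (suc n) zero    L       lt
    with A , ∣A∣ , A∉ ← avoid n 0 (tailsOut L)
           (≤-<-trans (subst (length (tailsOut L) ≤_) (length-tails L) (m≤n+m _ _)) lt)
    = outside ∷ A , ∣A∣ , A∉ ∘ ∈-tailsOut
  avoid (suc n) (suc r) L       lt with length (tailsIn L) <? n C r
  ... | yes p with A , ∣A∣ , A∉ ← avoid n r (tailsIn L) p
    = inside ∷ A , cong suc ∣A∣ , A∉ ∘ ∈-tailsIn
  ... | no ¬p
    with A , ∣A∣ , A∉ ← avoid n (suc r) (tailsOut L) (+-cancelˡ-< (n C r) _ _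
           (≤-<-trans (+-monoˡ-≤ (length (tailsOut L)) (≮⇒≥ ¬p))
             (subst₂ _<_ (sym (length-tails L)) (sym (nCk+nC[k+1]≡[n+1]C[k+1] n r)) lt)))
    = outside ∷ A , ∣A∣ , A∉ ∘ ∈-tailsOut

  -- Central binomial coefficients

  C-absorb : ∀ n k → suc k * (suc n C suc k) ≡ suc n * (n C k)
  C-absorb zero    zero    = refl
  C-absorb zero    (suc k) = trans (cong (suc (suc k) *_) (k>n⇒nCk≡0 (s<s (z<s {k}))))
    (trans (*-zeroʳ (suc (suc k))) (sym (cong (1 *_) (k>n⇒nCk≡0 (z<s {k})))))
  C-absorb (suc n) zero    = trans (*-identityˡ _) (trans (nC1≡n (suc (suc n))) (sym (*-identityʳ _)))
  C-absorb (suc n) (suc k) = begin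
    suc (suc k) * (suc (suc n) C suc (suc k))
      ≡⟨ cong (suc (suc k) *_) (sym (nCk+nC[k+1]≡[n+1]C[k+1] (suc n) (suc k))) ⟩
    suc (suc k) * ((suc n C suc k) + (suc n C suc (suc k)))
      ≡⟨ *-distribˡ-+ (suc (suc k)) (suc n C suc k) _ ⟩
    (suc n C suc k) + suc k * (suc n C suc k) + suc (suc k) * (suc n C suc (suc k))
      ≡⟨ cong₂ (λ x y → (suc n C suc k) + x + y) (C-absorb n k) (C-absorb n (suc k)) ⟩
    (suc n C suc k) + suc n * (n C k) + suc n * (n C suc k)
      ≡⟨ +-assoc (suc n C suc k) _ _ ⟩
    (suc n C suc k) + (suc n * (n C k) + suc n * (n C suc k))
      ≡⟨ cong ((suc n C suc k) +_) (sym (*-distribˡ-+ (suc n) (n C k) _)) ⟩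
    (suc n C suc k) + suc n * (n C k + n C suc k)
      ≡⟨ cong (λ x → (suc n C suc k) + suc n * x) (nCk+nC[k+1]≡[n+1]C[k+1] n k) ⟩
    suc (suc n) * (suc n C suc k) ∎
    where open ≡-Reasoning

  -- Defined by recursion so that `double (suc t)` unfolds to two successors and Pascal's rule
  -- applies to it directly.
  double : ℕ → ℕ
  double zero = zero
  double (suc n) = suc (suc (double n))

  C-odd-sym : ∀ s → suc (double s) C suc s ≡ suc (double s) C s
  C-odd-sym s = trans (nCk≡nC[n∸k] (s≤s (s≤double s))) (cong (suc (double s) C_) (double∸ s))
    where
    s≤double : ∀ s → s ≤ double s
    s≤double zero = z≤n
    s≤double (suc s) = s≤s (m≤n⇒m≤1+n (s≤double s))
    double∸ : ∀ s → double s ∸ s ≡ s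
    double∸ s = trans (cong (_∸ s) (d+ s)) (m+n∸n≡m s s)
      where
      d+ : ∀ s → double s ≡ s + s
      d+ zero = refl
      d+ (suc s) = cong suc (trans (cong suc (d+ s)) (sym (+-suc s s)))

  C-even : ∀ s → double (suc s) C suc s ≡ 2 * (suc (double s) C suc s)
  C-even s = begin
    double (suc s) C suc s                               ≡⟨ nCk+nC[k+1]≡[n+1]C[k+1] (suc (double s)) s ⟨
    suc (double s) C s + suc (double s) C suc s          ≡⟨ cong (_+ suc (double s) C suc s) (C-odd-sym s) ⟨
    suc (double s) C suc s + suc (double s) C suc s      ≡⟨ cong (suc (double s) C suc s +_) (+-identityʳ _) ⟨
    2 * (suc (double s) C suc s)                         ∎
    where open ≡-Reasoning

  C-central : ∀ t → 2 * (suc (double t) * (double t C t)) ≡ suc t * (double (suc t) C suc t)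
  C-central t = begin
    2 * (suc (double t) * (double t C t))              ≡⟨ cong (2 *_) (C-absorb (double t) t) ⟨
    2 * (suc t * (suc (double t) C suc t))             ≡⟨ swap 2 (suc t) (suc (double t) C suc t) ⟩
    suc t * (2 * (suc (double t) C suc t))             ≡⟨ cong (suc t *_) (C-even t) ⟨
    suc t * (double (suc t) C suc t)                   ∎
    where
    open ≡-Reasoning
    swap : ∀ a b c → a * (b * c) ≡ b * (a * c)
    swap = ℕSolver.solve-∀

  -- From `t` to `suc t` the left side grows by the factor 4 and, by `C-central`, the right side by
  -- 2(2t+3)/(t+1), which is larger.
  central-bound : ∀ t → 2 ^ suc (double t) ≤ suc t * (double (suc t) C suc t)
  central-bound zero    = ≤-refl
  central-bound (suc t) = begin
    2 * (2 * 2 ^ suc (double t))                          ≤⟨ *-monoʳ-≤ 2 (*-monoʳ-≤ 2 (central-bound t)) ⟩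
    2 * (2 * (suc t * c))                                 ≡⟨ cong (2 *_) (sym (*-assoc 2 (suc t) c)) ⟩
    2 * (2 * suc t * c)                                   ≤⟨ *-monoʳ-≤ 2 (*-monoˡ-≤ c (2*≤ (suc t))) ⟩
    2 * (suc (double (suc t)) * c)                        ≡⟨ C-central (suc t) ⟩
    suc (suc t) * (double (suc (suc t)) C suc (suc t))    ∎
    where
    open ≤-Reasoning
    c = double (suc t) C suc t
    double≡ : ∀ n → 2 * n ≡ double n
    double≡ zero    = refl
    double≡ (suc n) = trans (*-suc 2 n) (cong (2 +_) (double≡ n))
    2*≤ : ∀ n → 2 * n ≤ suc (double n)
    2*≤ n = ≤-trans (≤-reflexive (double≡ n)) (n≤1+n _)

  data Parity : ℕ → Set where
    even : ∀ t → Parity (double t)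
    odd  : ∀ t → Parity (suc (double t))

  halve : ∀ n → Parity n
  halve zero = even zero
  halve (suc n) with halve n
  ... | even t = odd t
  ... | odd t  = even (suc t)

  ⌊double/2⌋ : ∀ t → ⌊ double t /2⌋ ≡ t
  ⌊double/2⌋ zero    = refl
  ⌊double/2⌋ (suc t) = cong suc (⌊double/2⌋ t)

  ⌊1+double/2⌋ : ∀ t → ⌊ suc (double t) /2⌋ ≡ t
  ⌊1+double/2⌋ zero    = refl
  ⌊1+double/2⌋ (suc t) = cong suc (⌊1+double/2⌋ t)

  -- `2 + L` will be the number of hues. An odd number of hues reduces to the even number below it
  -- by Pascal's rule and symmetry.
  half-subsets : ∀ L → 2 ^ L ≤ ⌊ 2 + L /2⌋ * ((2 + L) C ⌊ 2 + L /2⌋)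
  half-subsets L with halve L
  ... | even t rewrite ⌊double/2⌋ t =
    ≤-trans (^-monoʳ-≤ 2 (n≤1+n (double t))) (central-bound t)
  ... | odd t rewrite ⌊1+double/2⌋ t = ≤-trans (central-bound t) (*-monoʳ-≤ (suc t)
    (≤-trans (m≤m+n _ _) (≤-reflexive (trans (nCk+nC[k+1]≡[n+1]C[k+1] (double (suc t)) (suc t)) (C-odd-sym (suc t))))))

  -- Splitting hue classes into bins

  length-filter-∷ : ∀ {A : Set} {P : A → Set} (P? : ∀ x → Dec (P x)) x xs →
    length (filter P? xs) ≤ length (filter P? (x ∷ xs))
  length-filter-∷ P? x xs with does (P? x)
  ... | true  = n≤1+n _
  ... | false = ≤-refl

  -- Sort the items by hue, and cut the sorted sequence into blocks of length k.
  -- An item of hue g in the q-th block goes into bin g + q: hue and block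
  -- number both grow along the sequence, so their sum determines both.
  module Binning {A : Set} (hue : A → ℕ) (k : ℕ) .{{_ : NonZero k}} (xs : List A) where

    #_at_ : List A → ℕ → ℕ
    # t at g = length (filter (λ y → hue y ≟ g) t)

    below : ℕ → List A → ℕ
    below g t = length (filter (λ y → hue y <? g) t)

    -- The place of `x` in the sequence sorted by hue, where `t` is the part of the list behind `x`:
    -- among items of equal hue, those nearer the end of the list come first.
    position : A → List A → ℕ
    position x t = below (hue x) xs + # t at hue x

    bin : A → List A → ℕ
    bin x t = hue x + position x t / k

    binned : List A → List (A × ℕ)
    binned []      = []
    binned (x ∷ t) = (x , bin x t) ∷ binned t

    binned-items : ∀ t → map proj₁ (binned t) ≡ t
    binned-items []      = refl
    binned-items (x ∷ t) = cong (x ∷_) (binned-items t)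

    data Suffix : List A → Set where
      whole  : Suffix xs
      behind : ∀ {x t} → Suffix (x ∷ t) → Suffix t

    suffix-at : ∀ {t} g → Suffix t → # t at g ≤ # xs at g
    suffix-at g whole = ≤-refl
    suffix-at g (behind {x} {t} s) = ≤-trans (length-filter-∷ (λ y → hue y ≟ g) x t) (suffix-at g s)

    head-at : ∀ {x t} → Suffix (x ∷ t) → # t at hue x < # xs at hue x
    head-at {x} {t} s = ≤-trans (≤-reflexive (cong length (sym (filter-accept (λ y → hue y ≟ hue x) {xs = t} refl))))
        (suffix-at (hue x) s)

    below+at : ∀ {g g′} t → g < g′ → below g t + # t at g ≤ below g′ t
    below+at [] _ = z≤n
    below+at {g} {g′} (y ∷ t) g<g′ with <-cmp (hue y) g | below+at t g<g′
    ... | tri< lt ¬e _ | ih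
      rewrite filter-accept (λ y → hue y <? g) {xs = t} lt
            | filter-reject (λ y → hue y ≟ g) {xs = t} ¬e
            | filter-accept (λ y → hue y <? g′) {xs = t} (<-trans lt g<g′) = s≤s ih
    ... | tri≈ ¬l refl _ | ih
      rewrite filter-reject (λ y → hue y <? g) {xs = t} ¬l
            | filter-accept (λ y → hue y ≟ g) {x = y} {xs = t} refl
            | filter-accept (λ y → hue y <? g′) {x = y} {xs = t} g<g′ = ≤-trans (≤-reflexive (+-suc _ _)) (s≤s ih)
    ... | tri> ¬l ¬e _ | ih
      rewrite filter-reject (λ y → hue y <? g) {xs = t} ¬l
            | filter-reject (λ y → hue y ≟ g) {xs = t} ¬e
      = ≤-trans ih (length-filter-∷ (λ y → hue y <? g′) y t)

    position< : ∀ {x t} → Suffix (x ∷ t) → position x t < below (hue x) xs + # xs at hue x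
    position< s = +-monoʳ-< _ (head-at s)

    private
      Spot : A × ℕ → Set
      Spot (x , b) = ∃[ t ] Suffix (x ∷ t) × b ≡ bin x t

      spots : ∀ {t} → Suffix t → All Spot (binned t)
      spots {[]}    _ = []
      spots {x ∷ t} s = (t , s , refl) ∷ spots (behind s)

      hue-order : ∀ {x t y u} → Suffix (x ∷ t) → Suffix (y ∷ u) → hue x < hue y → bin x t < bin y u
      hue-order {x} {t} {y} {u} s s′ lt = +-mono-<-≤ lt (/-monoˡ-≤ k
        (≤-trans (<⇒≤ (position< s)) (≤-trans (below+at xs lt) (m≤m+n _ _))))

    bin-determines-hue : ∀ {x y} → x ∈ binned xs → y ∈ binned xs →
                         proj₂ x ≡ proj₂ y → hue (proj₁ x) ≡ hue (proj₁ y)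
    bin-determines-hue {x , _} {y , _} x∈ y∈ eq
      with All.lookup (spots whole) x∈ | All.lookup (spots whole) y∈
    ... | t , s , refl | u , s′ , refl with <-cmp (hue x) (hue y)
    ...   | tri< lt _ _ = ⊥-elim (<⇒≢ (hue-order s s′ lt) eq)
    ...   | tri≈ _ e _  = e
    ...   | tri> _ _ gt = ⊥-elim (<⇒≢ (hue-order s′ s gt) (sym eq))

    bin-bound : ∀ {h} → All (λ x → hue x < h) xs → All (λ x → proj₂ x < h + length xs / k) (binned xs)
    bin-bound {h} hue<h = All.map bound (spots whole)
      where
      hue< : ∀ {x t} → Suffix (x ∷ t) → hue x < h
      hue< s = All.lookup hue<h (in-whole s (here refl))
        where
        in-whole : ∀ {t z} → Suffix t → z ∈ t → z ∈ xs
        in-whole whole    p = p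
        in-whole (behind s) p = in-whole s (there p)
      below≤ : ∀ g → below g xs ≤ length xs
      below≤ g = length-filter (λ y → hue y <? g) xs
      bound : ∀ {x} → Spot x → proj₂ x < h + length xs / k
      bound {x , _} (t , s , refl) = +-mono-<-≤ (hue< s) (/-monoˡ-≤ k
        (≤-trans (<⇒≤ (position< s)) (≤-trans (below+at xs (n<1+n (hue x))) (below≤ _))))

    load : ℕ → List A → ℕ
    load b t = length (filter (λ y → proj₂ y ≟ b) (binned t))

    private
      -- The second bound makes the first inductive. Items of bin `b` have hue `g` and block number
      -- `b ∸ g`, so their positions start at `(b ∸ g) * k` or later. If `x` joins them, its
      -- position minus that start is its remainder modulo `k`, hence below `k`.
      load-step : ∀ {b g} t → All (λ y → proj₂ y ≡ b → hue (proj₁ y) ≡ g) (binned t) →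
        load b t ≤ k × load b t ≤ (below g xs + # t at g) ∸ (b ∸ g) * k
      load-step [] _ = z≤n , z≤n
      load-step {b} {g} (x ∷ t) (hx ∷ ht) = extend hx (bin x t ≟ b) (load-step t ht)
        where
        p = position x t
        q≤ : p / k * k ≤ p
        q≤ = m/n*n≤m p k
        extend : ∀ {b g} → (bin x t ≡ b → hue x ≡ g) → Dec (bin x t ≡ b) →
          load b t ≤ k × load b t ≤ (below g xs + # t at g) ∸ (b ∸ g) * k →
          load b (x ∷ t) ≤ k × load b (x ∷ t) ≤ (below g xs + # (x ∷ t) at g) ∸ (b ∸ g) * k
        extend {b} {g} _ (no b≢) (ih₁ , ih₂)
          rewrite filter-reject (λ y → proj₂ y ≟ b) {x = x , bin x t} {xs = binned t} b≢ =
          ih₁ , ≤-trans ih₂ (∸-monoˡ-≤ ((b ∸ g) * k)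
                  (+-monoʳ-≤ (below g xs) (length-filter-∷ (λ y → hue y ≟ g) x t)))
        extend same (yes refl) (_ , ih₂) with refl ← same refl
          rewrite filter-accept (λ y → proj₂ y ≟ bin x t) {x = x , bin x t} {xs = binned t} refl
                | filter-accept (λ y → hue y ≟ hue x) {x = x} {xs = t} refl
                | m+n∸m≡n (hue x) (p / k)
                | +-suc (below (hue x) xs) (# t at hue x) =
          ≤-<-trans ih₂ (+-cancelʳ-< (p / k * k) _ _ (subst (_< k + p / k * k) (sym (m∸n+n≡m q≤))
            (subst (_< k + p / k * k) (sym (m≡m%n+[m/n]*n p k)) (+-monoˡ-< (p / k * k) (m%n<n p k)))))
          , ≤-trans (s≤s ih₂) (≤-reflexive (sym (+-∸-assoc 1 q≤)))

    bin-load : ∀ {x} → x ∈ binned xs → load (proj₂ x) xs ≤ k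
    bin-load {x} x∈ = proj₁ (load-step {g = hue (proj₁ x)} xs
      (All.tabulate λ y∈ e → bin-determines-hue y∈ x∈ e))

  -- Combinatorial form of the game

  -- Weights are fractions with the common denominator W.
  module Items (d k W : ℕ) where

    record Item : Set where
      field
        lo hi : ℕ
        lo≤hi : lo ≤ hi
        w     : Fin d → ℕ
        w≤W   : ∀ j → w j ≤ W

    open Item public

    Overlap : Item → Item → Set
    Overlap I J = lo I ≤ hi J × lo J ≤ hi I

    overlap? : ∀ I J → Dec (Overlap I J)
    overlap? I J = (lo I ≤? hi J) ×-dec (lo J ≤? hi I)

    Colored : Set
    Colored = Item × ℕ

    Meets : Colored → Colored → Set
    Meets x y = Overlap (proj₁ x) (proj₁ y) × proj₂ x ≡ proj₂ y

    meets? : ∀ x y → Dec (Meets x y)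
    meets? x y = overlap? (proj₁ x) (proj₁ y) ×-dec (proj₂ x ≟ proj₂ y)

    weightSum : Fin d → List Colored → ℕ
    weightSum j xs = sum (map (λ x → w (proj₁ x) j) xs)

    Fits : List Colored → Set
    Fits xs = length xs ≤ k × (∀ j → weightSum j xs ≤ W)

    -- Intervals of one color that share a point all meet the first of them, so it
    -- suffices to bound, for each interval, all those of its color that overlap it.
    Good : List Colored → Set
    Good xs = ∀ {x} → x ∈ xs → Fits (filter (meets? x) xs)

    weightSum-⊑ : ∀ {xs ys} j → xs ⊑ ys → weightSum j xs ≤ weightSum j ys
    weightSum-⊑ j []           = z≤n
    weightSum-⊑ j (y ∷ʳ s)     = ≤-trans (weightSum-⊑ j s) (m≤n+m _ _)
    weightSum-⊑ j (refl ∷ s)   = +-monoʳ-≤ _ (weightSum-⊑ j s)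

    fits-⊑ : ∀ {xs ys} → xs ⊑ ys → Fits ys → Fits xs
    fits-⊑ s (len , wt) = ≤-trans (length-mono-≤ s) len , λ j → ≤-trans (weightSum-⊑ j s) (wt j)

    meets-sym : ∀ x y → Meets x y → Meets y x
    meets-sym _ _ ((p , q) , e) = (q , p) , sym e

    good-++ : ∀ {xs ys} → Good xs → Good ys → (∀ {x y} → x ∈ xs → y ∈ ys → ¬ Meets x y) →
              Good (xs ++ ys)
    good-++ {xs} {ys} gx gy apart {x} x∈ with ∈-++⁻ xs x∈
    ... | inj₁ p rewrite filter-++ (meets? x) xs ys
                       | filter-none (meets? x) {xs = ys} (All.tabulate λ q → apart p q)
                       | ++-identityʳ (filter (meets? x) xs) = gx p
    ... | inj₂ q rewrite filter-++ (meets? x) xs ys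
                       | filter-none (meets? x) {xs = xs} (All.tabulate λ {y} p m → apart p q (meets-sym x y m))
      = gy q

    shift : ℕ → Colored → Colored
    shift c = map₂ (c +_)

    filter-shift : ∀ c x ys →
      filter (meets? (shift c x)) (map (shift c) ys) ≡ map (shift c) (filter (meets? x) ys)
    filter-shift c x [] = refl
    filter-shift c x (y ∷ ys) = extend (meets? x y)
      where
      extend : Dec (Meets x y) →
        filter (meets? (shift c x)) (map (shift c) (y ∷ ys)) ≡ map (shift c) (filter (meets? x) (y ∷ ys))
      extend (yes m) = trans (filter-accept (meets? (shift c x)) (map₂ (cong (c +_)) m))
        (trans (cong (shift c y ∷_) (filter-shift c x ys))
               (cong (map (shift c)) (sym (filter-accept (meets? x) m))))
      extend (no ¬m) = trans (filter-reject (meets? (shift c x)) (¬m ∘ map₂ (+-cancelˡ-≡ c _ _)))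
        (trans (filter-shift c x ys) (cong (map (shift c)) (sym (filter-reject (meets? x) ¬m))))

    weightSum-shift : ∀ c j ys → weightSum j (map (shift c) ys) ≡ weightSum j ys
    weightSum-shift c j ys = cong sum (sym (map-∘ ys))

    fits-shift : ∀ c ys → Fits ys → Fits (map (shift c) ys)
    fits-shift c ys (len , wt) =
        subst (_≤ k) (sym (length-map (shift c) ys)) len
      , λ j → subst (_≤ W) (sym (weightSum-shift c j ys)) (wt j)

    good-shift : ∀ c {xs} → Good xs → Good (map (shift c) xs)
    good-shift c {xs} g x∈ with x , x∈xs , refl ← ∈-map⁻ (shift c) x∈ =
      subst Fits (sym (filter-shift c x xs)) (fits-shift c (filter (meets? x) xs) (g x∈xs))

    Hist : Set
    Hist = List Colored

    Clash : Item → Item → Set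
    Clash I J = Overlap I J × ∃[ j ] W < w I j + w J j

    clash? : ∀ I J → Dec (Clash I J)
    clash? I J = overlap? I J ×-dec any? (λ j → W <? w I j + w J j)

    Allowed : Item → ℕ → Hist → Set
    Allowed I γ H = All (λ x → Clash I (proj₁ x) → γ ≢ proj₂ x) H

    allowed? : ∀ I γ H → Dec (Allowed I γ H)
    allowed? I γ H = All.all? (λ x → clash? I (proj₁ x) →-dec ¬? (γ ≟ proj₂ x)) H

    -- Play that ends in a history satisfying G. Answers that repeat the color of a
    -- clashing interval are excluded; unlike validity over the reals, this exclusion
    -- is decidable, so that the tree can be turned into a strategy.
    data Force (G : Hist → Set) (H : Hist) : Set where
      done : G H → Force G H
      ask  : (I : Item) → (∀ γ → Allowed I γ H → Force G ((I , γ) ∷ H)) → Force G H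

    infixl 1 _>>=_
    _>>=_ : ∀ {G G′ H} → Force G H → (∀ {H′} → G H′ → Force G′ H′) → Force G′ H
    done g   >>= f = f g
    ask I F  >>= f = ask I λ γ ok → F γ ok >>= f

    Extends : (Hist → Set) → Hist → Hist → Set
    Extends P H H′ = ∃[ ys ] H′ ≡ ys ++ H × P ys

  -- From natural numbers to reals

  frac : (W : ℕ) .{{_ : NonZero W}} → ℕ → ℚ
  frac W a = ℤ.+ a ℚ./ W

  frac-mono : ∀ W .{{_ : NonZero W}} a b → a ≤ b → frac W a ℚ.≤ frac W b
  frac-mono (suc V) a b a≤b = D.ratio-≤ a b V V (*-monoˡ-≤ (suc V) a≤b)

  frac-mono-< : ∀ W .{{_ : NonZero W}} {a b} → a < b → frac W a ℚ.< frac W b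
  frac-mono-< (suc V) {a} {b} a<b = D.ratio-< a b V V (*-monoˡ-< (suc V) a<b)

  frac-cancel : ∀ W .{{_ : NonZero W}} a b → frac W a ℚ.≤ frac W b → a ≤ b
  frac-cancel W a b le = ≮⇒≥ λ b<a → ℚ.<-irrefl refl (ℚ.<-≤-trans (frac-mono-< W b<a) le)

  frac-0 : ∀ W .{{_ : NonZero W}} → frac W 0 ≡ 0ℚ
  frac-0 (suc V) = ℚ.≤-antisym (D.ratio-≤ 0 0 V 0 z≤n) (D.ratio-≤ 0 0 0 V z≤n)

  frac-W : ∀ W .{{_ : NonZero W}} → frac W W ≡ 1ℚ
  frac-W (suc V) = ℚ.≤-antisym (D.ratio-≤ (suc V) 1 V 0 (≤-reflexive (*-comm (suc V) 1)))
                               (D.ratio-≤ 1 (suc V) 0 V (≤-reflexive (*-comm 1 (suc V))))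

  frac-+ : ∀ W .{{_ : NonZero W}} a b → frac W (a + b) ≡ frac W a ℚ.+ frac W b
  frac-+ W@(suc _) zero b = trans (sym (ℚ.+-identityˡ _)) (cong (ℚ._+ frac W b) (sym (frac-0 W)))
  frac-+ W@(suc V) (suc a) b = begin
    frac W (suc (a + b))                     ≡⟨ D.ratio-suc (a + b) V ⟩
    frac W (a + b) ℚ.+ frac W 1              ≡⟨ cong (ℚ._+ frac W 1) (frac-+ W a b) ⟩
    (frac W a ℚ.+ frac W b) ℚ.+ frac W 1     ≡⟨ swap (frac W a) (frac W b) (frac W 1) ⟩
    (frac W a ℚ.+ frac W 1) ℚ.+ frac W b     ≡⟨ cong (ℚ._+ frac W b) (D.ratio-suc a V) ⟨
    frac W (suc a) ℚ.+ frac W b              ∎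
    where
    open ≡-Reasoning
    open ℚSolver.+-*-Solver
    swap : ∀ p q r → (p ℚ.+ q) ℚ.+ r ≡ (p ℚ.+ r) ℚ.+ q
    swap = solve 3 (λ p q r → (p :+ q) :+ r := (p :+ r) :+ q) refl

  -- The order of the reals holds only up to every positive `ε`; for rationals, density removes the
  -- slack.
  ≤-from-slack : ∀ {p q} → (∀ {ε} → 0ℚ ℚ.< ε → p ℚ.≤ q ℚ.+ ε) → p ℚ.≤ q
  ≤-from-slack {p} {q} slack = ℚ.≮⇒≥ λ q<p →
    let (r , q<r , r<p) = ℚ.<-dense q<p
        0<ε = subst (ℚ._< r ℚ.- q) (ℚ.+-inverseʳ q) (ℚ.+-monoˡ-< (ℚ.- q) q<r)
    in ℚ.<-irrefl refl (ℚ.<-≤-trans r<p (subst (p ℚ.≤_) (cancel q r) (slack 0<ε)))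
    where
    open ℚSolver.+-*-Solver
    cancel : ∀ q r → q ℚ.+ (r ℚ.- q) ≡ r
    cancel = solve 2 (λ q r → q :+ (r :- q) := r) refl

  ≤ᴿ-pointwise : ∀ {x y} → (∀ i → seq x i ℚ.≤ seq y i) → x D.≤ y
  ≤ᴿ-pointwise {x} {y} le {ε} 0<ε = 0 , λ {i} _ → ℚ.≤-trans (le i)
    (subst (ℚ._≤ seq y i ℚ.+ ε) (ℚ.+-identityʳ (seq y i)) (ℚ.+-monoʳ-≤ (seq y i) (ℚ.<⇒≤ 0<ε)))

  ≤ᴿ-trans : ∀ {x y z} → x D.≤ y → y D.≤ z → x D.≤ z
  ≤ᴿ-trans {x} {y} {z} x≤y y≤z {ε} 0<ε =
    let (M , hM) = x≤y (D.0<½* 0<ε)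
        (N , hN) = y≤z (D.0<½* 0<ε)
    in M ⊔ N , λ {i} i≥ → ℚ.≤-trans (hM (m⊔n≤o⇒m≤o M N i≥))
         (subst (seq y i ℚ.+ ½ ℚ.* ε ℚ.≤_)
           (trans (ℚ.+-assoc (seq z i) _ _) (cong (seq z i ℚ.+_) (D.½*+½* ε)))
           (ℚ.+-monoˡ-≤ (½ ℚ.* ε) (hN (m⊔n≤o⇒n≤o M N i≥))))

  fromℚ-cancel : ∀ {p q} → fromℚ p D.≤ fromℚ q → p ℚ.≤ q
  fromℚ-cancel le = ≤-from-slack λ 0<ε → let (N , h) = le 0<ε in h ≤-refl

  fromℕ-mono : ∀ {a b} → a ≤ b → fromℕ a D.≤ fromℕ b
  fromℕ-mono {a} {b} a≤b = ≤ᴿ-pointwise {fromℕ a} {fromℕ b} λ _ → frac-mono 1 a b a≤b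

  fromℕ-cancel : ∀ {a b} → fromℕ a D.≤ fromℕ b → a ≤ b
  fromℕ-cancel {a} {b} le = frac-cancel 1 a b (fromℚ-cancel le)

  does-true : ∀ {P : Set} (P? : Dec P) → does P? ≡ true → P
  does-true (yes p) _ = p

  -- Lists of colored items as colored collections of weighted intervals

  module Bridge (d k W : ℕ) {{W≢0 : NonZero W}} where
    open Items d k W

    toWI : Item → D.WeightedInterval d
    toWI I = record
      { left       = fromℕ (lo I)
      ; right      = fromℕ (hi I)
      ; left≤right = fromℕ-mono {lo I} {hi I} (lo≤hi I)
      ; weight     = λ j → fromℚ (frac W (w I j))
      ; 0≤weight   = λ j → ≤ᴿ-pointwise {D.0ℝ} {fromℚ (frac W (w I j))} λ _ →
                       subst (ℚ._≤ frac W (w I j)) (frac-0 W) (frac-mono W 0 (w I j) z≤n)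
      ; weight≤1   = λ j → ≤ᴿ-pointwise {fromℚ (frac W (w I j))} {D.1ℝ} λ _ →
                       subst (frac W (w I j) ℚ.≤_) (frac-W W) (frac-mono W (w I j) W (w≤W I j))
      }

    intervals : (L : List Item) → Vec (D.WeightedInterval d) (length L)
    intervals []      = []
    intervals (I ∷ L) = toWI I ∷ intervals L

    items : List Colored → List Item
    items = map proj₁

    colors : (xs : List Colored) → Vec ℕ (length (items xs))
    colors []            = []
    colors ((_ , γ) ∷ xs) = γ ∷ colors xs

    select : (xs : List Colored) → Subset (length (items xs)) → List Colored
    select []       []          = []
    select (x ∷ xs) (true ∷ S)  = x ∷ select xs S
    select (x ∷ xs) (false ∷ S) = select xs S

    select-⊑ : ∀ xs S → select xs S ⊑ xs
    select-⊑ []       []          = []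
    select-⊑ (x ∷ xs) (true ∷ S)  = refl ∷ select-⊑ xs S
    select-⊑ (x ∷ xs) (false ∷ S) = x ∷ʳ select-⊑ xs S

    ∣S∣≡length : ∀ xs S → ∣ S ∣ ≡ length (select xs S)
    ∣S∣≡length []       []          = refl
    ∣S∣≡length (x ∷ xs) (true ∷ S)  = cong suc (∣S∣≡length xs S)
    ∣S∣≡length (x ∷ xs) (false ∷ S) = ∣S∣≡length xs S

    seq-∑ : ∀ xs S j t →
      seq (D.∑[ S ] (λ i → D.weight (lookup (intervals (items xs)) i) j)) t ≡ frac W (weightSum j (select xs S))
    seq-∑ []       []          j t = sym (frac-0 W)
    seq-∑ (x ∷ xs) (true ∷ S)  j t =
      trans (cong (frac W (w (proj₁ x) j) ℚ.+_) (seq-∑ xs S j t))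
            (sym (frac-+ W (w (proj₁ x) j) (weightSum j (select xs S))))
    seq-∑ (x ∷ xs) (false ∷ S) j t = trans (ℚ.+-identityˡ _) (seq-∑ xs S j t)

    Covers : ℝ → ℕ → Colored → Set
    Covers p γ x = (p D.∈ᴵ toWI (proj₁ x)) × proj₂ x ≡ γ

    CoversAt : ℝ → ℕ → (xs : List Colored) → Fin (length (items xs)) → Set
    CoversAt p γ xs i = (p D.∈ᴵ lookup (intervals (items xs)) i) × lookup (colors xs) i ≡ γ

    select-covers : ∀ p γ xs S → (∀ i → i Subset.∈ S → CoversAt p γ xs i) →
                    All (Covers p γ) (select xs S)
    select-covers p γ []       []          _ = []
    select-covers p γ (x ∷ xs) (true ∷ S)  h =
      h zero here ∷ select-covers p γ xs S (λ i i∈ → h (suc i) (there i∈))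
    select-covers p γ (x ∷ xs) (false ∷ S) h = select-covers p γ xs S (λ i i∈ → h (suc i) (there i∈))

    -- The point `p` is an arbitrary real, but the endpoints are natural numbers: comparing them
    -- through `p` gives inequalities that can be pulled back to ℕ.
    covers⇒meets : ∀ {p γ x y} → Covers p γ x → Covers p γ y → Meets x y
    covers⇒meets {p} {x = x} {y = y} ((a , b) , e) ((a′ , b′) , e′) =
      ( fromℕ-cancel {lo (proj₁ x)} {hi (proj₁ y)}
          (≤ᴿ-trans {fromℕ (lo (proj₁ x))} {p} {fromℕ (hi (proj₁ y))} a b′)
      , fromℕ-cancel {lo (proj₁ y)} {hi (proj₁ x)}
          (≤ᴿ-trans {fromℕ (lo (proj₁ y))} {p} {fromℕ (hi (proj₁ x))} a′ b))
      , trans e (sym e′)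

    good⇒fits : ∀ {p γ} xs S → Good xs → All (Covers p γ) (select xs S) → Fits (select xs S)
    good⇒fits {p} {γ} xs S g cov = go (select xs S) cov (select-⊑ xs S)
      where
      go : ∀ ys → All (Covers p γ) ys → ys ⊑ xs → Fits ys
      go []       _            _ = z≤n , λ _ → z≤n
      go (y ∷ ys) (cy ∷ cys) sub =
        fits-⊑ (subst (_⊑ filter (meets? y) xs)
                   (filter-all (meets? y) (All.map (λ {z} → covers⇒meets {p} {γ} {y} {z} cy) (cy ∷ cys)))
                 (filter⁺ (meets? y) (meets? y) (λ { refl m → m }) sub))
               (g (Sublist.lookup sub (here refl)))

    good⇒coloring : ∀ xs → Good xs → D.IsColoring k (intervals (items xs)) (colors xs)
    good⇒coloring xs g γ p S mem =
      subst (_≤ k) (sym (∣S∣≡length xs S)) (proj₁ fits)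
      , λ j → ≤ᴿ-pointwise {D.∑[ S ] _} {D.1ℝ} λ t →
          subst₂ ℚ._≤_ (sym (seq-∑ xs S j t)) (frac-W W)
            (frac-mono W (weightSum j (select xs S)) W (proj₂ fits j))
      where
      fits : Fits (select xs S)
      fits = good⇒fits {p} {γ} xs S g (select-covers p γ xs S λ i → Equivalence.to (mem i))

    module _ (p γ : ℕ) where

      Over : Colored → Set
      Over x = (lo (proj₁ x) ≤ p × p ≤ hi (proj₁ x)) × proj₂ x ≡ γ

      over? : ∀ x → Dec (Over x)
      over? x = ((lo (proj₁ x) ≤? p) ×-dec (p ≤? hi (proj₁ x))) ×-dec (proj₂ x ≟ γ)

      over⇒covers : ∀ x → Over x → Covers (fromℕ p) γ x
      over⇒covers x ((a , b) , e) = (fromℕ-mono {lo (proj₁ x)} {p} a , fromℕ-mono {p} {hi (proj₁ x)} b) , e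

      covers⇒over : ∀ x → Covers (fromℕ p) γ x → Over x
      covers⇒over x ((a , b) , e) = (fromℕ-cancel {lo (proj₁ x)} {p} a , fromℕ-cancel {p} {hi (proj₁ x)} b) , e

      -- At a natural point `p`, membership is decidable, so the exact index set that `IsColoring`
      -- asks for can be computed.
      pick : (xs : List Colored) → Subset (length (items xs))
      pick []       = []
      pick (x ∷ xs) = does (over? x) ∷ pick xs

      select-pick : ∀ xs → select xs (pick xs) ≡ filter over? xs
      select-pick []       = refl
      select-pick (x ∷ xs) with does (over? x)
      ... | true  = cong (x ∷_) (select-pick xs)
      ... | false = select-pick xs

      pick-exact : ∀ xs i → i Subset.∈ pick xs ⇔ CoversAt (fromℕ p) γ xs i
      pick-exact (x ∷ xs) zero = mk⇔
        (λ z∈ → over⇒covers x (does-true (over? x) ([]=⇒lookup z∈)))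
        (λ c → lookup⇒[]= zero _ (dec-true (over? x) (covers⇒over x c)))
      pick-exact (x ∷ xs) (suc i) = mk⇔
        (λ { (there i∈) → Equivalence.to (pick-exact xs i) i∈ })
        (λ c → there (Equivalence.from (pick-exact xs i) c))

    -- Validity is tested at the larger of the two left endpoints, which lies in both intervals. If
    -- they clashed and shared a color, that color would be overloaded there in some coordinate.
    coloring⇒allowed : ∀ {I γ} H →
      D.IsColoring k (toWI I ∷ intervals (items H)) (γ ∷ colors H) → Allowed I γ H
    coloring⇒allowed {I} {γ} H valid = All.tabulate λ {x} → clash⇒≢ {x}
      where
      clash⇒≢ : ∀ {x} → x ∈ H → Clash I (proj₁ x) → γ ≢ proj₂ x
      clash⇒≢ {J , _} x∈ ((I≤J , J≤I) , j , heavy) refl = <⇒≱ heavy (≤-trans (≤-trans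
          (+-monoʳ-≤ (w I j) (≤-trans (m≤m+n (w J j) 0)
            (weightSum-⊑ j (Sublist.from∈ (∈-filter⁺ (over? p γ) x∈ overJ)))))
          (≤-reflexive (sym (cong (weightSum j) (trans (select-pick p γ ((I , γ) ∷ H))
            (filter-accept (over? p γ) overI))))))
        total)
        where
        p = lo I ⊔ lo J
        S = pick p γ ((I , γ) ∷ H)
        overI : Over p γ (I , γ)
        overI = (m≤m⊔n (lo I) (lo J) , ⊔-lub (lo≤hi I) J≤I) , refl
        overJ : Over p γ (J , γ)
        overJ = (m≤n⊔m (lo I) (lo J) , ⊔-lub I≤J (lo≤hi J)) , refl
        total : weightSum j (select ((I , γ) ∷ H) S) ≤ W
        total = frac-cancel W (weightSum j (select ((I , γ) ∷ H) S)) W (≤-from-slack λ {ε} 0<ε →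
          let (N , h) = proj₂ (valid γ (fromℕ p) S (pick-exact p γ ((I , γ) ∷ H))) j 0<ε
          in subst₂ ℚ._≤_ (seq-∑ ((I , γ) ∷ H) S j N) (cong (ℚ._+ ε) (sym (frac-W W))) (h ≤-refl))

  -- Layers

  filter-map-⊑ : ∀ {A B : Set} {P : A → Set} {Q : B → Set} (f : A → B)
    (P? : ∀ x → Dec (P x)) (Q? : ∀ x → Dec (Q x)) xs →
    (∀ {x} → x ∈ xs → P x → Q (f x)) → map f (filter P? xs) ⊑ filter Q? (map f xs)
  filter-map-⊑ f P? Q? [] _ = []
  filter-map-⊑ f P? Q? (x ∷ xs) imp with P? x | Q? (f x) | filter-map-⊑ f P? Q? xs (imp ∘ there)
  ... | yes p | yes q | ih = refl ∷ ih
  ... | yes p | no ¬q | ih = ⊥-elim (¬q (imp (here refl) p))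
  ... | no ¬p | yes q | ih = f x ∷ʳ ih
  ... | no ¬p | no ¬q | ih = ih

  map-filter-⊑ : ∀ {A B : Set} {P : A → Set} {Q : B → Set} (f : A → B)
    (P? : ∀ x → Dec (P x)) (Q? : ∀ x → Dec (Q x)) xs →
    (∀ {x} → Q (f x) → P x) → filter Q? (map f xs) ⊑ map f (filter P? xs)
  map-filter-⊑ f P? Q? [] _ = []
  map-filter-⊑ f P? Q? (x ∷ xs) imp with P? x | Q? (f x) | map-filter-⊑ f P? Q? xs imp
  ... | yes p | yes q | ih = refl ∷ ih
  ... | yes p | no ¬q | ih = f x ∷ʳ ih
  ... | no ¬p | yes q | ih = ⊥-elim (¬p (imp q))
  ... | no ¬p | no ¬q | ih = ih

  module Layers (d k W h s : ℕ) .{{_ : NonZero d}} .{{_ : NonZero k}}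
                (0<s : 0 < s) (enough : d ≤ s * (h C s)) where
    open Items d k W public

    -- The size of a palette. A bin is a hue below `h` plus a block number, which is at most `d / k`
    -- for a layer of at most `d` intervals.
    Q : ℕ
    Q = h + d / k

    -- Some coordinate leaves room at most d·e, so any interval through a common
    -- point all of whose weights exceed d·e clashes.
    Peak : ℕ → Item → Set
    Peak e I = ∃[ j ] W ≤ w I j + d * e

    Paintable : ℕ → List Colored → Set
    Paintable n ys = ∃[ xs ] map proj₁ xs ≡ map proj₁ ys × Good xs × (∀ {x} → x ∈ xs → proj₂ x < n)

    palette : List Colored → List ℕ
    palette = map proj₂

    -- `fresh` is what lets layers be stacked: an earlier interval of a much smaller scale `e′`
    -- leaves room at most d·e′ in some coordinate, while every weight in the layer is built to be
    -- at least `e`.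
    record Layer (H₀ : Hist) (l r e : ℕ) (ys : List Colored) : Set where
      field
        located : ∀ {x} → x ∈ ys → lo (proj₁ x) ≡ l × hi (proj₁ x) ≡ r
        peaked  : ∀ {x} → x ∈ ys → Peak e (proj₁ x)
        fresh   : ∀ {x y e′} → x ∈ ys → y ∈ H₀ → l ≤ hi (proj₁ y) → lo (proj₁ y) ≤ r →
                  Peak e′ (proj₁ y) → d * e′ < e → proj₂ x ≢ proj₂ y
        many    : d ≤ s * distinct (palette ys)
        paint   : Paintable Q ys

    module Build (H₀ : Hist) (l r e : ℕ) (l≤r : l ≤ r) (0<e : 0 < e) (room : d * (suc d * e) ≤ W) where

      record Cell : Set where
        constructor cell
        field
          item  : Item
          color : ℕ
          own   : Fin d
          hue   : Fin h
      open Cell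

      colored : Cell → Colored
      colored z = item z , color z

      hist : List Cell → Hist
      hist = map colored

      weight : Cell → Fin d → ℕ
      weight z = w (item z)

      -- The state when `z` joins the earlier cells `zs` of its layer. Outside its own coordinate,
      -- `z` may weigh more than `e` only where an earlier cell of another hue is the owner
      -- (`flat`), so `z` does not burden the owners of its own hue.
      record New (zs : List Cell) (z : Cell) : Set where
        field
          placed  : lo (item z) ≡ l × hi (item z) ≡ r
          ordinal : toℕ (own z) ≡ length zs
          peak    : weight z (own z) + d * e ≡ W
          floor   : ∀ j → e ≤ weight z j
          cap     : ∀ j → j ≢ own z → weight z j ≤ suc d * e
          flat    : ∀ j → j ≢ own z → (∀ {y} → y ∈ zs → own y ≡ j → hue y ≡ hue z) → weight z j ≤ e
          unlike  : ∀ {y e′} → y ∈ H₀ → l ≤ hi (proj₁ y) → lo (proj₁ y) ≤ r →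
                    Peak e′ (proj₁ y) → d * e′ < e → color z ≢ proj₂ y
      open New

      data Built : List Cell → Set where
        []  : Built []
        _∷_ : ∀ {z zs} → New zs z → Built zs → Built (z ∷ zs)

      own<length : ∀ {zs y} → Built zs → y ∈ zs → toℕ (own y) < length zs
      own<length (n ∷ _)  (here refl) = s≤s (≤-reflexive (ordinal n))
      own<length (_ ∷ b) (there y∈)  = m≤n⇒m≤1+n (own<length b y∈)

      own-injective : ∀ {zs x y} → Built zs → x ∈ zs → y ∈ zs → own x ≡ own y → x ≡ y
      own-injective _ (here refl) (here refl) _ = refl
      own-injective (n ∷ b) (here refl) (there y∈) e =
        ⊥-elim (<⇒≢ (own<length b y∈) (trans (cong toℕ (sym e)) (ordinal n)))
      own-injective (n ∷ b) (there x∈) (here refl) e =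
        ⊥-elim (<⇒≢ (own<length b x∈) (trans (cong toℕ e) (ordinal n)))
      own-injective (_ ∷ b) (there x∈) (there y∈) e = own-injective b x∈ y∈ e

      -- Offline coloring of a layer: a hue class fits into one color by weight

      hueSum : Fin h → Fin d → List Cell → ℕ
      hueSum g j zs = sum (map (λ z → weight z j) (filter (λ z → hue z ≟ᶠ g) zs))

      hueSum-same : ∀ {g} j z zs → hue z ≡ g → hueSum g j (z ∷ zs) ≡ weight z j + hueSum g j zs
      hueSum-same j z zs e = cong (sum ∘ map (λ z → weight z j)) (filter-accept (λ z → hue z ≟ᶠ _) e)

      Owns : Fin h → Fin d → Cell → Set
      Owns g j z = hue z ≡ g × own z ≡ j

      hueSum-cap : ∀ {zs} g j → Built zs → (∀ {z} → z ∈ zs → ¬ Owns g j z) →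
                   hueSum g j zs ≤ length zs * (suc d * e)
      hueSum-cap g j [] _ = z≤n
      hueSum-cap {z ∷ zs} g j (n ∷ b) none with hue z ≟ᶠ g
      ... | yes p = +-mono-≤ (cap n j (λ j≡ → none (here refl) (p , sym j≡))) (hueSum-cap g j b (none ∘ there))
      ... | no ¬p = ≤-trans (hueSum-cap g j b (none ∘ there)) (m≤n+m _ _)

      -- Coordinates are taken in order, so the hypothesis on `j` means that it has no owner yet,
      -- and `flat` applies to every cell.
      hueSum-flat : ∀ {zs} g j → Built zs → length zs ≤ toℕ j → hueSum g j zs ≤ length zs * e
      hueSum-flat g j [] _ = z≤n
      hueSum-flat {z ∷ zs} g j (n ∷ b) len with hue z ≟ᶠ g
      ... | yes p = +-mono-≤ (flat n j (λ j≡ → <⇒≢ len (trans (sym (ordinal n)) (cong toℕ (sym j≡))))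
                                          (λ y∈ o → ⊥-elim (<⇒≢ (≤-trans (m≤n⇒m≤1+n (own<length b y∈)) len)
                                                                (cong toℕ o))))
                                (hueSum-flat g j b (<⇒≤ len))
      ... | no ¬p = ≤-trans (hueSum-flat g j b (<⇒≤ len)) (m≤n+m _ _)

      -- The owner leaves room d·e in coordinate `j`. Every other cell of its hue adds at most `e`:
      -- an earlier one because `j` had no owner, a later one because the owner has the same hue.
      hueSum-owned : ∀ {zs y} g j → Built zs → y ∈ zs → Owns g j y → hueSum g j zs + d * e ≤ W + length zs * e
      hueSum-owned {z ∷ zs} g j (n ∷ b) (here refl) (refl , refl) = begin
        hueSum g j (z ∷ zs) + d * e              ≡⟨ cong (_+ d * e) (hueSum-same j z zs refl) ⟩
        (weight z j + hueSum g j zs) + d * e     ≡⟨ +-assoc (weight z j) _ _ ⟩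
        weight z j + (hueSum g j zs + d * e)     ≡⟨ cong (weight z j +_) (+-comm (hueSum g j zs) (d * e)) ⟩
        weight z j + (d * e + hueSum g j zs)     ≡⟨ +-assoc (weight z j) _ _ ⟨
        (weight z j + d * e) + hueSum g j zs     ≡⟨ cong (_+ hueSum g j zs) (peak n) ⟩
        W + hueSum g j zs                        ≤⟨ +-monoʳ-≤ W (hueSum-flat g j b (≤-reflexive (sym (ordinal n)))) ⟩
        W + length zs * e                        ≤⟨ +-monoʳ-≤ W (m≤n+m _ e) ⟩
        W + (e + length zs * e)                  ∎
        where open ≤-Reasoning
      hueSum-owned {z ∷ zs} {y} g j (n ∷ b) (there y∈) (refl , refl) with hue z ≟ᶠ g
      ... | no ¬p = ≤-trans (hueSum-owned g j b y∈ (refl , refl)) (+-monoʳ-≤ W (m≤n+m _ e))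
      ... | yes p = begin
        (weight z j + hueSum g j zs) + d * e     ≡⟨ +-assoc (weight z j) _ _ ⟩
        weight z j + (hueSum g j zs + d * e)     ≤⟨ +-mono-≤
          (flat n j (λ j≡ → <⇒≢ (own<length b y∈) (trans (cong toℕ j≡) (ordinal n)))
                    (λ x∈ o → trans (cong hue (own-injective b x∈ y∈ o)) (sym p)))
          (hueSum-owned g j b y∈ (refl , refl)) ⟩
        e + (W + length zs * e)                  ≡⟨ +-assoc e W _ ⟨
        (e + W) + length zs * e                  ≡⟨ cong (_+ length zs * e) (+-comm e W) ⟩
        (W + e) + length zs * e                  ≡⟨ +-assoc W e _ ⟩
        W + (e + length zs * e)                  ∎
        where open ≤-Reasoning

      hueSum≤W : ∀ {zs} g j → Built zs → length zs ≤ d → hueSum g j zs ≤ W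
      hueSum≤W {zs} g j b len with Any.any? (λ z → (hue z ≟ᶠ g) ×-dec (own z ≟ᶠ j)) zs
      -- Without an owner of hue `g`, there are at most `d` weights of at most (d+1)·e each, and
      -- `room` is made for them.
      ... | no ¬p = ≤-trans (hueSum-cap g j b (λ z∈ o → ¬p (lose z∈ o)))
                      (≤-trans (*-monoˡ-≤ (suc d * e) len) room)
      ... | yes p with find p
      ...   | y , y∈ , o = +-cancelʳ-≤ (d * e) _ _
                      (≤-trans (hueSum-owned g j b y∈ o) (+-monoʳ-≤ W (*-monoˡ-≤ e len)))

      module Paint (zs : List Cell) (b : Built zs) (len : length zs ≤ d) where
        open Binning (toℕ ∘ hue) k zs

        asColored : Cell × ℕ → Colored
        asColored (z , c) = item z , c

        painted : List Colored
        painted = map asColored (binned zs)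

        painted-items : map proj₁ painted ≡ map proj₁ (hist zs)
        painted-items = begin
          map proj₁ (map asColored (binned zs))   ≡⟨ map-∘ (binned zs) ⟨
          map (item ∘ proj₁) (binned zs)          ≡⟨ map-∘ (binned zs) ⟩
          map item (map proj₁ (binned zs))        ≡⟨ cong (map item) (binned-items zs) ⟩
          map item zs                             ≡⟨ map-∘ zs ⟩
          map proj₁ (hist zs)                     ∎
          where open ≡-Reasoning

        sum-⊑ : ∀ {xs ys : List Cell} j → xs ⊑ ys →
                sum (map (λ z → weight z j) xs) ≤ sum (map (λ z → weight z j) ys)
        sum-⊑ j []         = z≤n
        sum-⊑ j (y ∷ʳ p)   = ≤-trans (sum-⊑ j p) (m≤n+m _ _)
        sum-⊑ j (refl ∷ p) = +-monoʳ-≤ _ (sum-⊑ j p)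

        -- Binning bounds the number of intervals by `k`; as a bin contains a single hue, the bound
        -- on the whole hue class takes care of the weights.
        same-bin-fits : ∀ {x} → x ∈ binned zs →
                        Fits (map asColored (filter (λ y → proj₂ y ≟ proj₂ x) (binned zs)))
        same-bin-fits {x} x∈ =
            ≤-trans (≤-reflexive (length-map asColored same)) (bin-load x∈)
          , λ j → begin
              weightSum j (map asColored same)                   ≡⟨ cong sum (map-∘ same) ⟨
              sum (map (λ y → weight (proj₁ y) j) same)          ≡⟨ cong sum (map-∘ same) ⟩
              sum (map (λ z → weight z j) (map proj₁ same))      ≤⟨ sum-⊑ j
                (filter-map-⊑ proj₁ (λ y → proj₂ y ≟ proj₂ x) (λ z → hue z ≟ᶠ g) (binned zs)
                  (λ y∈ e → toℕ-injective (bin-determines-hue y∈ x∈ e))) ⟩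
              hueSum g j (map proj₁ (binned zs))                 ≡⟨ cong (hueSum g j) (binned-items zs) ⟩
              hueSum g j zs                                      ≤⟨ hueSum≤W g j b len ⟩
              W                                                  ∎
          where
          open ≤-Reasoning
          same = filter (λ y → proj₂ y ≟ proj₂ x) (binned zs)
          g = hue (proj₁ x)

        painted-good : Good painted
        painted-good x∈ with ∈-map⁻ asColored x∈
        ... | x , x∈b , refl = fits-⊑
          (map-filter-⊑ asColored (λ y → proj₂ y ≟ proj₂ x) (meets? (asColored x)) (binned zs) (sym ∘ proj₂))
          (same-bin-fits x∈b)

        painted-bound : ∀ {x} → x ∈ painted → proj₂ x < Q
        painted-bound x∈ with ∈-map⁻ asColored x∈
        ... | x , x∈b , refl = ≤-trans
          (All.lookup (bin-bound {h} (All.universal (λ z → toℕ<n (hue z)) zs)) x∈b)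
          (+-monoʳ-≤ h (/-monoˡ-≤ k len))

      -- Forcing many colors within a layer

      hues : ℕ → List Cell → Subset h
      hues γ []       = ⊥
      hues γ (z ∷ zs) = if does (color z ≟ γ) then ⁅ hue z ⁆ ∪ hues γ zs else hues γ zs

      colorsOf : List Cell → List ℕ
      colorsOf = map color

      hues-⊆ : ∀ {γ A} zs → (∀ {z} → z ∈ zs → color z ≡ γ → hue z ∈ˢ A) → hues γ zs ⊆ˢ A
      hues-⊆ [] _ g∈ = ⊥-elim (∉⊥ g∈)
      hues-⊆ {γ} {A} (z ∷ zs) imp {g} g∈ = split (color z ≟ γ) g∈
        where
        split : (c : Dec (color z ≡ γ)) → g ∈ˢ (if does c then ⁅ hue z ⁆ ∪ hues γ zs else hues γ zs) → g ∈ˢ A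
        split (yes c) g∈ with x∈p∪q⁻ ⁅ hue z ⁆ (hues γ zs) g∈
        ... | inj₁ g∈z = subst (_∈ˢ A) (sym (x∈⁅y⁆⇒x≡y (hue z) g∈z)) (imp (here refl) c)
        ... | inj₂ g∈′ = hues-⊆ zs (imp ∘ there) g∈′
        split (no _) g∈′ = hues-⊆ zs (imp ∘ there) g∈′

      hues-unused : ∀ {γ} zs → ¬ γ ∈ colorsOf zs → hues γ zs ≡ ⊥
      hues-unused [] _ = refl
      hues-unused {γ} (z ∷ zs) γ∉ = trans
        (cong (λ b → if b then ⁅ hue z ⁆ ∪ hues γ zs else hues γ zs) (dec-false (color z ≟ γ) (γ∉ ∘ here ∘ sym)))
        (hues-unused zs (γ∉ ∘ there))

      -- Each use of a color is charged to a different hue of that color, so no color is used more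
      -- than `s` times.
      Spread : List Cell → Set
      Spread zs = ∀ γ → length (filter (_≟ γ) (colorsOf zs)) ≤ ∣ hues γ zs ∣ × ∣ hues γ zs ∣ ≤ s

      spread-[] : Spread []
      spread-[] γ = z≤n , subst (_≤ s) (sym (∣⊥∣≡0 h)) z≤n

      spread-∷ : ∀ {A z zs} → ∣ A ∣ ≡ s → hues (color z) zs ⊆ˢ A → hue z ∈ˢ A → hue z ∉ˢ hues (color z) zs →
                 Spread zs → Spread (z ∷ zs)
      spread-∷ {A} {z} {zs} ∣A∣ ⊆A z∈A z∉ sp γ = split (color z ≟ γ)
        where
        new = hues (color z) (z ∷ zs)
        new≡ : new ≡ ⁅ hue z ⁆ ∪ hues (color z) zs
        new≡ = cong (λ b → if b then ⁅ hue z ⁆ ∪ hues (color z) zs else hues (color z) zs) 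
                 (dec-true (color z ≟ color z) refl)
        strict : ∣ hues (color z) zs ∣ < ∣ new ∣
        strict = subst (λ p → ∣ hues (color z) zs ∣ < ∣ p ∣) (sym new≡)
          (p⊂q⇒∣p∣<∣q∣ ((λ x∈ → x∈p∪q⁺ (inj₂ x∈)) , hue z , x∈p∪q⁺ (inj₁ (x∈⁅x⁆ (hue z))) , z∉))
        inA : ∣ new ∣ ≤ s
        inA = subst₂ (λ p n → ∣ p ∣ ≤ n) (sym new≡) ∣A∣ (p⊆q⇒∣p∣≤∣q∣ λ x∈ →
          case x∈p∪q⁻ ⁅ hue z ⁆ _ x∈ of λ where
          (inj₁ p) → subst (_∈ˢ A) (sym (x∈⁅y⁆⇒x≡y (hue z) p)) z∈A
          (inj₂ p) → ⊆A p)
        split : Dec (color z ≡ γ) →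
                length (filter (_≟ γ) (colorsOf (z ∷ zs))) ≤ ∣ hues γ (z ∷ zs) ∣ ×
                ∣ hues γ (z ∷ zs) ∣ ≤ s
        split (yes refl) = subst (_≤ ∣ new ∣) (cong length (sym (filter-accept (_≟ color z) {xs = colorsOf zs} refl)))
                             (≤-trans (s≤s (proj₁ (sp γ))) strict) , inA
        split (no ¬c) = subst₂ (λ a p → a ≤ ∣ p ∣ × ∣ p ∣ ≤ s)
          (cong length (sym (filter-reject (_≟ γ) {xs = colorsOf zs} ¬c)))
          (cong (λ b → if b then ⁅ hue z ⁆ ∪ hues γ zs else hues γ zs) (sym (dec-false (color z ≟ γ) ¬c)))
          (sp γ)

      length-colors : ∀ zs → Spread zs → length zs ≤ s * distinct (colorsOf zs)
      length-colors zs sp = ≤-trans (≤-reflexive (sym (length-map color zs)))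
        (distinct-multiplicity (colorsOf zs) λ γ → ≤-trans (proj₁ (sp γ)) (proj₂ (sp γ)))

      new-of : ∀ {zs z} → Built zs → z ∈ zs → ∃[ ys ] New ys z
      new-of (n ∷ _) (here refl) = _ , n
      new-of (_ ∷ b) (there z∈) = new-of b z∈

      Blocked : Subset h → List Cell → Fin d → Set
      Blocked A zs j = Any.Any (λ y → own y ≡ j × hue y ∉ˢ A) zs

      blocked? : ∀ A zs j → Dec (Blocked A zs j)
      blocked? A zs j = Any.any? (λ y → (own y ≟ᶠ j) ×-dec ¬? (hue y ∈ˢ? A)) zs

      de≤W : d * e ≤ W
      de≤W = ≤-trans (*-monoʳ-≤ d (m≤m+n e (d * e))) room

      e+de≤W : suc d * e ≤ W
      e+de≤W = ≤-trans (m≤n*m (suc d * e) d) room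

      -- The offered interval clashes exactly with the earlier intervals of hue outside
      -- A: in their own coordinates, where they leave room d·e, its weight is (d+1)·e;
      -- the own coordinates of all others have room for d weights e.
      module Offer (A : Subset h) (zs : List Cell) (b : Built zs) (lt : length zs < d) where

        top : Fin d
        top = fromℕ< lt

        weightBy : ∀ {j} → Dec (j ≡ top) → Dec (Blocked A zs j) → ℕ
        weightBy (yes _) _       = W ∸ d * e
        weightBy (no _)  (yes _) = suc d * e
        weightBy (no _)  (no _)  = e

        weight′ : Fin d → ℕ
        weight′ j = weightBy (j ≟ᶠ top) (blocked? A zs j)

        offer : Item
        offer = record { lo = l ; hi = r ; lo≤hi = l≤r ; w = weight′
                       ; w≤W = λ j → bound (j ≟ᶠ top) (blocked? A zs j) }
          where
          bound : ∀ {j} (p : Dec (j ≡ top)) (q : Dec (Blocked A zs j)) → weightBy p q ≤ W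
          bound (yes _) _       = m∸n≤m W (d * e)
          bound (no _)  (yes _) = e+de≤W
          bound (no _)  (no _)  = ≤-trans (m≤m+n e (d * e)) e+de≤W

        offer-floor : ∀ j → e ≤ weight′ j
        offer-floor j = go (j ≟ᶠ top) (blocked? A zs j)
          where
          go : ∀ {j} (p : Dec (j ≡ top)) (q : Dec (Blocked A zs j)) → e ≤ weightBy p q
          go (yes _) _       = m+n≤o⇒m≤o∸n e e+de≤W
          go (no _)  (yes _) = m≤m+n e (d * e)
          go (no _)  (no _)  = ≤-refl

        offer-blocked : ∀ {y} → y ∈ zs → hue y ∉ˢ A → suc d * e ≤ weight′ (own y)
        offer-blocked {y} y∈ y∉A = go (own y ≟ᶠ top) (blocked? A zs (own y))
          where
          go : (p : Dec (own y ≡ top)) (q : Dec (Blocked A zs (own y))) → suc d * e ≤ weightBy p q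
          go (yes p) _       = ⊥-elim (<⇒≢ (own<length b y∈) (trans (cong toℕ p) (toℕ-fromℕ< lt)))
          go (no _)  (yes _) = ≤-refl
          go (no _)  (no ¬q) = ⊥-elim (¬q (lose y∈ (refl , y∉A)))

        clash-blocked : ∀ {y} → y ∈ zs → hue y ∉ˢ A → Clash offer (item y)
        clash-blocked {y} y∈ y∉A with _ , n ← new-of b y∈ with placed n | peak n
        ... | refl , refl | pk = (l≤r , l≤r) , own y , (begin-strict
          W                                        ≡⟨ pk ⟨
          weight y (own y) + d * e                 <⟨ +-monoʳ-< (weight y (own y)) (m<n+m (d * e) 0<e) ⟩
          weight y (own y) + suc d * e             ≤⟨ +-monoʳ-≤ (weight y (own y)) (offer-blocked y∈ y∉A) ⟩
          weight y (own y) + weight′ (own y)       ≡⟨ +-comm (weight y (own y)) _ ⟩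
          weight′ (own y) + weight y (own y)       ∎)
          where open ≤-Reasoning

        clash-lower : ∀ (y : Colored) e′ → l ≤ hi (proj₁ y) → lo (proj₁ y) ≤ r → Peak e′ (proj₁ y) →
                      d * e′ < e → Clash offer (proj₁ y)
        clash-lower y e′ l≤ ≤r (j , pk) lt′ = (l≤ , ≤r) , j , (begin-strict
          W                                ≤⟨ pk ⟩
          w (proj₁ y) j + d * e′           <⟨ +-monoʳ-< _ lt′ ⟩
          w (proj₁ y) j + e                ≤⟨ +-monoʳ-≤ _ (offer-floor j) ⟩
          w (proj₁ y) j + weight′ j        ≡⟨ +-comm (w (proj₁ y) j) _ ⟩
          weight′ j + w (proj₁ y) j        ∎)
          where open ≤-Reasoning

        offer-new : ∀ {γ g} → g ∈ˢ A → Allowed offer γ (hist zs ++ H₀) → New zs (cell offer γ top g)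
        offer-new {γ} {g} g∈A ok = record
          { placed  = refl , refl
          ; ordinal = toℕ-fromℕ< lt
          ; peak    = at-top (top ≟ᶠ top) (blocked? A zs top)
          ; floor   = offer-floor
          ; cap     = λ j j≢ → under-cap j≢ (j ≟ᶠ top) (blocked? A zs j)
          ; flat    = λ j j≢ same → under-flat j≢ same (j ≟ᶠ top) (blocked? A zs j)
          ; unlike  = λ {y} {e′} y∈ l≤ ≤r pk lt′ →
                        All.lookup ok (∈-++⁺ʳ (hist zs) y∈) (clash-lower y e′ l≤ ≤r pk lt′)
          }
          where
          at-top : (p : Dec (top ≡ top)) (q : Dec (Blocked A zs top)) → weightBy p q + d * e ≡ W
          at-top (yes _) _  = m∸n+n≡m de≤W
          at-top (no ¬p) _  = ⊥-elim (¬p refl)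
          under-cap : ∀ {j} → j ≢ top → (p : Dec (j ≡ top)) (q : Dec (Blocked A zs j)) → weightBy p q ≤ suc d * e
          under-cap j≢ (yes p) _       = ⊥-elim (j≢ p)
          under-cap j≢ (no _)  (yes _) = ≤-refl
          under-cap j≢ (no _)  (no _)  = m≤m+n e (d * e)
          under-flat : ∀ {j} → j ≢ top → (∀ {y} → y ∈ zs → own y ≡ j → hue y ≡ g) →
                       (p : Dec (j ≡ top)) (q : Dec (Blocked A zs j)) → weightBy p q ≤ e
          under-flat j≢ same (yes p) _       = ⊥-elim (j≢ p)
          -- A blocked coordinate has an owner of hue outside `A`, whereas `same` would give that
          -- owner the hue `g` from `A`.
          under-flat j≢ same (no _)  (yes q) with y , y∈ , oy , y∉A ← find q =
            ⊥-elim (y∉A (subst (_∈ˢ A) (sym (same y∈ oy)) g∈A))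
          under-flat j≢ same (no _)  (no _)  = ≤-refl

      finish : ∀ zs → Built zs → length zs ≤ d → d ≤ s * distinct (colorsOf zs) → Layer H₀ l r e (hist zs)
      finish zs b len many = record
        { located = λ x∈ → case new x∈ of λ { (_ , _ , n , refl) → placed n }
        ; peaked  = λ x∈ → case new x∈ of λ { (z , _ , n , refl) → own z , ≤-reflexive (sym (peak n)) }
        ; fresh   = λ x∈ → case new x∈ of λ { (_ , _ , n , refl) → unlike n }
        ; many    = subst (λ cs → d ≤ s * distinct cs) (map-∘ zs) many
        ; paint   = painted , painted-items , painted-good , painted-bound
        }
        where
        open Paint zs b len
        new : ∀ {x} → x ∈ hist zs → ∃[ z ] ∃[ ys ] New ys z × x ≡ colored z
        new x∈ with z , z∈ , eq ← ∈-map⁻ colored x∈ with ys , n ← new-of b z∈ = z , ys , n , eq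

      missing-hue : ∀ {A} γ zs → hues γ zs ⊆ˢ A → hues γ zs ≢ A → ∃[ g ] g ∈ˢ A × g ∉ˢ hues γ zs
      missing-hue {A} γ zs sub ne with any? (λ g → (g ∈ˢ? A) ×-dec ¬? (g ∈ˢ? hues γ zs))
      ... | yes p = p
      ... | no ¬p = ⊥-elim (ne (⊆-antisym sub λ {g} g∈ → decidable-stable (g ∈ˢ? hues γ zs) λ g∉ → ¬p (g , g∈ , g∉)))

      -- With A different from the hue set of every color, Presenter can always
      -- give the new interval a hue that its color does not have yet.
      choose : ∀ zs → s * distinct (colorsOf zs) < d → ∃[ A ] ∣ A ∣ ≡ s × (∀ γ → hues γ zs ≢ A)
      choose zs few with A , ∣A∣ , A∉ ← avoid h s (map (λ γ → hues γ zs) (deduplicate _≟_ (colorsOf zs)))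
          (subst (_< h C s) (sym (length-map (λ γ → hues γ zs) (deduplicate _≟_ (colorsOf zs))))
            (*-cancelˡ-< s _ _ (<-≤-trans few enough)))
        = A , ∣A∣ , other
        where
        other : ∀ γ → hues γ zs ≢ A
        other γ refl with γ ∈? colorsOf zs
        ... | yes γ∈ = A∉ (∈-map⁺ (λ γ → hues γ zs) (∈-deduplicate⁺ _≟_ γ∈))
        ... | no γ∉  = <⇒≢ 0<s (trans (sym (∣⊥∣≡0 h)) (trans (cong ∣_∣ (sym (hues-unused zs γ∉))) ∣A∣))

      next-position : ∀ {a} fuel → a + suc fuel ≡ d → a < d
      next-position fuel eq = subst (_ <_) eq (m<m+n _ z<s)

      -- `fuel` counts the intervals that may still come. When it runs out, all `d` coordinates are
      -- owned, and `Spread` turns the `d` intervals into enough colors; the play ends earlier if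
      -- the colors suffice already.
      play : ∀ fuel zs → Built zs → Spread zs → length zs + fuel ≡ d →
             Force (Extends (Layer H₀ l r e) H₀) (hist zs ++ H₀)
      play zero zs b sp len = done (hist zs , refl , finish zs b (≤-reflexive len′)
          (subst (_≤ s * distinct (colorsOf zs)) len′ (length-colors zs sp)))
        where
        len′ : length zs ≡ d
        len′ = trans (sym (+-identityʳ _)) len
      play (suc fuel) zs b sp len with d ≤? s * distinct (colorsOf zs)
      ... | yes enough′ = done (hist zs , refl , finish zs b (<⇒≤ (next-position fuel len)) enough′)
      ... | no few with A , ∣A∣ , ≢A ← choose zs (≰⇒> few) = ask offer respond
        where
        open Offer A zs b (next-position fuel len)
        respond : ∀ γ → Allowed offer γ (hist zs ++ H₀) →
                  Force (Extends (Layer H₀ l r e) H₀) ((offer , γ) ∷ hist zs ++ H₀)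
        respond γ ok =
          -- An earlier interval of color `γ` with a hue outside `A` would clash with the offer, so
          -- `γ` would not be allowed.
          let inA : hues γ zs ⊆ˢ A
              inA = hues-⊆ zs λ {z} z∈ cz → decidable-stable (hue z ∈ˢ? A) λ z∉A →
                All.lookup ok (∈-++⁺ˡ (∈-map⁺ colored z∈)) (clash-blocked z∈ z∉A) (sym cz)
              (g , g∈A , g∉) = missing-hue γ zs inA (≢A γ)
          in play fuel (cell offer γ top g ∷ zs) (offer-new g∈A ok ∷ b)
                  (spread-∷ {A} {cell offer γ top g} {zs} ∣A∣ inA g∈A g∉ sp)
                  (trans (sym (+-suc _ fuel)) len)

    layer : ∀ H l r e → l ≤ r → 0 < e → d * (suc d * e) ≤ W → Force (Extends (Layer H l r e) H) H
    layer H l r e l≤r 0<e room = play d [] [] spread-[] refl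
      where open Build H l r e l≤r 0<e room

  -- Towers

  module _ {A : Set} {R : A → A → Set} {P : ℕ → A → Set} (P? : ∀ u x → Dec (P u x)) where

    private
      rest : ∀ u (U : List ℕ) xs → 3 * 2 ^ suc (length U) < length xs →
             length (filter (P? u) xs) ≤ 3 * 2 ^ length U →
             3 * 2 ^ length U < length (filter (¬? ∘ P? u) xs)
      rest u U xs big few = +-cancelˡ-< n _ _ (begin-strict
        n + n                                                              ≡⟨ dbl (2 ^ length U) ⟩
        3 * 2 ^ suc (length U)                                             <⟨ big ⟩
        length xs                                                          ≡⟨ length-filter-split (P? u) xs ⟩
        length (filter (P? u) xs) + length (filter (¬? ∘ P? u) xs)         ≤⟨ +-monoˡ-≤ _ few ⟩
        n + length (filter (¬? ∘ P? u) xs)                                 ∎)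
        where
        open ≤-Reasoning
        n = 3 * 2 ^ length U
        dbl : ∀ a → 3 * a + 3 * a ≡ 3 * (2 * a)
        dbl = ℕSolver.solve-∀

    -- For each `u` in `U`, either the elements with `P u` or those without are numerous enough to
    -- continue with; the number at least halves no further than the exponent allows. Filtering
    -- preserves the order `R`.
    pigeonhole : ∀ U xs → AllPairs R xs → 3 * 2 ^ length U < length xs →
      ∃[ ys ] 3 < length ys × AllPairs R ys × ys ⊆ xs ×
              (∀ {u x y} → u ∈ U → x ∈ ys → y ∈ ys → P u x → P u y)
    pigeonhole []      xs R-xs big = xs , big , R-xs , id , λ ()
    pigeonhole (u ∷ U) xs R-xs big with 3 * 2 ^ length U <? length (filter (P? u) xs)
    ... | yes p with ys , len , R-ys , sub , alike ← pigeonhole U _ (AllPairs.filter⁺ (P? u) R-xs) p =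
      ys , len , R-ys , (λ x∈ → proj₁ (∈-filter⁻ (P? u) {xs = xs} (sub x∈))) , λ where
        (here refl) _ y∈ _  → proj₂ (∈-filter⁻ (P? u) {xs = xs} (sub y∈))
        (there u∈)          → alike u∈
    ... | no ¬p with ys , len , R-ys , sub , alike ←
                       pigeonhole U _ (AllPairs.filter⁺ (¬? ∘ P? u) R-xs) (rest u U xs big (≮⇒≥ ¬p)) =
      ys , len , R-ys , (λ x∈ → proj₁ (∈-filter⁻ (¬? ∘ P? u) {xs = xs} (sub x∈))) , λ
        { (here refl) x∈ _ Px → ⊥-elim (proj₂ (∈-filter⁻ (¬? ∘ P? u) {xs = xs} (sub x∈)) Px)
        ; (there u∈)          → alike u∈ }

  allPairs-compare : ∀ {A : Set} {R : A → A → Set} {xs x y} → AllPairs R xs → 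
    x ∈ xs → y ∈ xs → x ≡ y ⊎ R x y ⊎ R y x
  allPairs-compare _        (here refl) (here refl) = inj₁ refl
  allPairs-compare (r ∷ _)  (here refl) (there y∈)  = inj₂ (inj₁ (All.lookup r y∈))
  allPairs-compare (r ∷ _)  (there x∈)  (here refl) = inj₂ (inj₂ (All.lookup r x∈))
  allPairs-compare (_ ∷ rs) (there x∈)  (there y∈)  = allPairs-compare rs x∈ y∈

  -- Three new scales per level, each large enough for its layers to clash with every
  -- layer of a smaller scale.
  scaleFor : ℕ → ℕ → ℕ
  scaleFor d zero    = 1
  scaleFor d (suc m) = suc d * (suc d * (suc d * scaleFor d m))

  scaleFor-mono : ∀ d m → scaleFor d m ≤ scaleFor d (suc m)
  scaleFor-mono d m = ≤-trans (m≤n*m _ (suc d)) (≤-trans (m≤n*m _ (suc d)) (m≤n*m _ (suc d)))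

  0<scaleFor : ∀ d m → 0 < scaleFor d m
  0<scaleFor d zero    = s≤s z≤n
  0<scaleFor d (suc m) = ≤-trans (0<scaleFor d m) (scaleFor-mono d m)

  module Towers (d k W h s : ℕ) .{{_ : NonZero d}} .{{_ : NonZero k}}
                (0<s : 0 < s) (enough : d ≤ s * (h C s)) where
    open Layers d k W h s 0<s enough public

    Painted : (Colored → Set) → List Colored → Set
    Painted P ys = ∃[ xs ] map proj₁ xs ≡ map proj₁ ys × Good xs × (∀ {x} → x ∈ xs → P x)

    painted-map : ∀ {P P′ ys} → (∀ {x} → P x → P′ x) → Painted P ys → Painted P′ ys
    painted-map f (xs , eq , g , p) = xs , eq , g , f ∘ p

    painted-++ : ∀ {P P′ ys zs} → (∀ {x y} → P x → P′ y → ¬ Meets x y) →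
                 Painted P ys → Painted P′ zs → Painted (λ x → P x ⊎ P′ x) (ys ++ zs)
    painted-++ {ys = ys} {zs} apart (xs , eq , g , p) (xs′ , eq′ , g′ , p′) =
        xs ++ xs′
      , trans (map-++ proj₁ xs xs′) (trans (cong₂ _++_ eq eq′) (sym (map-++ proj₁ ys zs)))
      , good-++ g g′ (λ x∈ y∈ → apart (p x∈) (p′ y∈))
      , λ x∈ → case ∈-++⁻ xs x∈ of λ { (inj₁ q) → inj₁ (p q) ; (inj₂ q) → inj₂ (p′ q) }

    painted-shift : ∀ c {P ys} → Painted P ys → Painted (λ x → ∃[ y ] P y × x ≡ shift c y) ys
    painted-shift c {P} {ys} (xs , eq , g , p) =
        map (shift c) xs
      , trans (sym (map-∘ xs)) eq
      , good-shift c g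
      , λ x∈ → case ∈-map⁻ (shift c) x∈ of λ { (y , y∈ , e) → y , p y∈ , e }

    -- Recoloring keeps the items, so facts about their location survive it.
    painted-items : ∀ {P Z : Colored → Set} {ys} → (∀ {x y} → proj₁ x ≡ proj₁ y → Z y → Z x) →
                    (∀ {y} → y ∈ ys → Z y) → Painted P ys → Painted (λ x → Z x × P x) ys
    painted-items {P} {Z} {ys} resp z (xs , eq , g , p) = xs , eq , g , λ x∈ →
      case ∈-map⁻ proj₁ (subst (_ ∈_) eq (∈-map⁺ proj₁ x∈)) of λ { (y , y∈ , e) → resp e (z y∈) , p x∈ }

    scale : ℕ → ℕ
    scale = scaleFor d

    e<suc : ∀ e → 0 < e → d * e < suc d * e
    e<suc e 0<e = m<n+m (d * e) 0<e

    peak-mono : ∀ {e e′ I} → e ≤ e′ → Peak e I → Peak e′ I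
    peak-mono e≤ (j , p) = j , ≤-trans p (+-monoʳ-≤ _ (*-monoʳ-≤ d e≤))

    -- The intervals lie strictly between `l` and `r`, so neighbouring towers with a common end, and
    -- layers that only reach an end, stay clear of them. `many` means (5m+2)·d/(2s) colors, written
    -- without division.
    record Tower (m l r : ℕ) (ys : List Colored) : Set where
      field
        l<r    : l < r
        within : ∀ {x} → x ∈ ys → l < lo (proj₁ x) × hi (proj₁ x) < r
        peaked : ∀ {x} → x ∈ ys → Peak (scale m) (proj₁ x)
        many   : (5 * m + 2) * d ≤ 2 * (s * distinct (palette ys))
        paint  : Paintable (suc m * Q) ys

    record Copy (m : ℕ) : Set where
      field
        start end : ℕ
        body      : List Colored
        tower     : Tower m start end body
      open Tower tower public
    open Copy

    _≺_ : ∀ {m} → Copy m → Copy m → Set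
    c ≺ c′ = end c ≤ start c′

    bodies : ∀ {m} → List (Copy m) → List Colored
    bodies cs = concatMap body cs

    body⊆bodies : ∀ {m} {c : Copy m} {cs} → c ∈ cs → body c ⊆ bodies cs
    body⊆bodies c∈ x∈ = ∈-concat⁺′ x∈ (∈-map⁺ body c∈)

    bodies⁻ : ∀ {m x} (cs : List (Copy m)) → x ∈ bodies cs → ∃[ c ] c ∈ cs × x ∈ body c
    bodies⁻ cs x∈ with ∈-concat⁻′ (map body cs) x∈
    ... | b , x∈b , b∈ with ∈-map⁻ body b∈
    ...   | c , c∈ , refl = c , c∈ , x∈b

    Inside : ∀ {m} → Copy m → Colored → Set
    Inside c x = start c < lo (proj₁ x) × hi (proj₁ x) < end c

    module _ {m : ℕ} {F : Copy m → Set} (F? : ∀ c → Dec (F c)) where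

      -- Copies in F make way for a layer painted with the lowest Q colors.
      Raised : Copy m → Colored → Set
      Raised c x = Inside c x × ((F c × Q ≤ proj₂ x × proj₂ x < suc (suc m) * Q) ⊎ (¬ F c × proj₂ x < suc m * Q))

      paint-copy : ∀ c → Painted (Raised c) (body c)
      paint-copy c = go (F? c)
        where
        base : Painted (λ x → Inside c x × proj₂ x < suc m * Q) (body c)
        base = painted-items (λ { refl p → p }) (within c) (paint c)
        go : Dec (F c) → Painted (Raised c) (body c)
        go (no ¬f) = painted-map (λ (i , p) → i , inj₂ (¬f , p)) base
        go (yes f) with xs , eq , g , p ← painted-shift Q base =
          xs , eq , g , λ x∈ → case p x∈ of λ
            { (y , (i , lt) , refl) → i , inj₁ (f , m≤m+n Q (proj₂ y) , +-monoʳ-< Q lt) }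

      paint-copies : ∀ cs → AllPairs (λ c c′ → c′ ≺ c) cs → Painted (λ x → ∃[ c ] c ∈ cs × Raised c x) (bodies cs)
      paint-copies [] _ = [] , refl , (λ ()) , λ ()
      paint-copies (c ∷ cs) (before ∷ sorted) = painted-map
        (λ { (inj₁ r) → c , here refl , r ; (inj₂ (c′ , c′∈ , r)) → c′ , there c′∈ , r })
        (painted-++ (λ {x} {y} → apart {x} {y}) (paint-copy c) (paint-copies cs sorted))
        where
        apart : ∀ {x y} → Raised c x → (∃[ c′ ] c′ ∈ cs × Raised c′ y) → ¬ Meets x y
        apart ((s<x , _) , _) (c′ , c′∈ , (_ , y<e) , _) ((x≤y , _) , _) =
          <⇒≱ (<-≤-trans y<e (≤-trans (All.lookup before c′∈) (<⇒≤ s<x))) x≤y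

    -- Counting the new colors of a level

    Disjoint-layer : ∀ {H a b e ys zs} → Layer H a b e ys → zs ⊆ H → ∀ {e′} → d * e′ < e →
      (∀ {y} → y ∈ zs → a ≤ hi (proj₁ y) × lo (proj₁ y) ≤ b × Peak e′ (proj₁ y)) →
      Disjoint (palette ys) (palette zs)
    Disjoint-layer L zs⊆ lt near p q with ∈-map⁻ proj₂ p | ∈-map⁻ proj₂ q
    ... | x , x∈ , refl | y , y∈ , eq =
      let (a≤ , ≤b , pk) = near y∈ in Layer.fresh L x∈ (zs⊆ y∈) a≤ ≤b pk lt eq

    layer-vs-copy : ∀ {m H a b e ys} (c : Copy m) → Layer H a b e ys → body c ⊆ H → d * scale m < e →
      a ≤ start c → end c ≤ b → Disjoint (palette ys) (palette (body c))
    layer-vs-copy c L sub lt a≤ ≤b = Disjoint-layer L sub lt λ {y} y∈ →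
      let (s< , <e) = within c y∈ ; y≤ = lo≤hi (proj₁ y)
      in ≤-trans a≤ (≤-trans (<⇒≤ s<) y≤) , ≤-trans y≤ (≤-trans (<⇒≤ <e) ≤b) , peaked c y∈

    layer-vs-layer : ∀ {H H′ a b a′ b′ e e′ ys zs} → Layer H a b e ys → Layer H′ a′ b′ e′ zs → zs ⊆ H → d * e′ < e →
      a ≤ b′ → a′ ≤ b → Disjoint (palette ys) (palette zs)
    layer-vs-layer L L′ sub lt a≤ ≤b = Disjoint-layer L sub lt λ y∈ → case Layer.located L′ y∈ of λ
      { (refl , refl) → a≤ , ≤b , Layer.peaked L′ y∈ }

    ++-all : ∀ {P : Colored → Set} xs {ys} → (∀ {x} → x ∈ xs → P x) → (∀ {x} → x ∈ ys → P x) →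
             ∀ {x} → x ∈ xs ++ ys → P x
    ++-all xs p q x∈ = [ p , q ]′ (∈-++⁻ xs x∈)

    -- In units of d/(2s) colors, a layer is worth 2, a tower of level `m` is worth 5m+2, and the
    -- new colors `X` are worth 5 on top of the palette `K` of one copy.
    tower-gain : ∀ m {X K Y} → (5 * m + 2) * d ≤ 2 * (s * distinct K) → 5 * d ≤ 2 * (s * distinct X) →
      Disjoint X K → X ++ K ⊆ Y → (5 * suc m + 2) * d ≤ 2 * (s * distinct Y)
    tower-gain m {X} {K} {Y} old new dis sub = begin
      (5 * suc m + 2) * d                                  ≡⟨ split m d ⟩
      5 * d + (5 * m + 2) * d                              ≤⟨ +-mono-≤ new old ⟩
      2 * (s * distinct X) + 2 * (s * distinct K)          ≡⟨ factor s (distinct X) (distinct K) ⟩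
      2 * (s * (distinct X + distinct K))                  ≤⟨ *-monoʳ-≤ 2 (*-monoʳ-≤ s
                                                               (≤-trans (distinct-++-disjoint dis) (distinct-mono sub))) ⟩
      2 * (s * distinct Y)                                 ∎
      where
      open ≤-Reasoning
      split : ∀ m d → (5 * suc m + 2) * d ≡ 5 * d + (5 * m + 2) * d
      split = ℕSolver.solve-∀
      factor : ∀ s a b → 2 * (s * a) + 2 * (s * b) ≡ 2 * (s * (a + b))
      factor = ℕSolver.solve-∀

    gain-varied : ∀ {Z U} → 3 * d ≤ 2 * (s * distinct U) → d ≤ s * distinct Z → Disjoint Z U →
      5 * d ≤ 2 * (s * distinct (Z ++ U))
    gain-varied {Z} {U} varied z dis = begin
      5 * d                                            ≡⟨ split d ⟩
      2 * d + 3 * d                                    ≤⟨ +-mono-≤ (*-monoʳ-≤ 2 z) varied ⟩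
      2 * (s * distinct Z) + 2 * (s * distinct U)      ≡⟨ factor s (distinct Z) (distinct U) ⟩
      2 * (s * (distinct Z + distinct U))              ≤⟨ *-monoʳ-≤ 2 (*-monoʳ-≤ s (distinct-++-disjoint dis)) ⟩
      2 * (s * distinct (Z ++ U))                      ∎
      where
      open ≤-Reasoning
      split : ∀ d → 5 * d ≡ 2 * d + 3 * d
      split = ℕSolver.solve-∀
      factor : ∀ s a b → 2 * (s * a) + 2 * (s * b) ≡ 2 * (s * (a + b))
      factor = ℕSolver.solve-∀

    -- B may reuse colors of D, but only those that A does not have.
    gain-similar : ∀ {A B E D} → 2 * (s * distinct (A ++ D)) ≤ 3 * d →
      d ≤ s * distinct A → d ≤ s * distinct B → d ≤ s * distinct E → d ≤ s * distinct D →
      Disjoint B A → Disjoint E (B ++ D) → 5 * d ≤ 2 * (s * distinct (E ++ B ++ D))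
    gain-similar {A} {B} {E} {D} similar a b c δ B∥A E∥BD = +-cancelʳ-≤ (2 * (s * AD)) _ _ (begin
      5 * d + 2 * (s * AD)                             ≤⟨ +-monoʳ-≤ (5 * d) similar ⟩
      5 * d + 3 * d                                    ≡⟨ regroup d ⟩
      2 * d + (2 * (d + d) + 2 * d)                    ≤⟨ +-mono-≤ (*-monoʳ-≤ 2 c)
                                                            (+-mono-≤ (*-monoʳ-≤ 2 (+-mono-≤ b a)) (*-monoʳ-≤ 2 δ)) ⟩
      2 * (s * distinct E) + (2 * (s * distinct B + s * distinct A) + 2 * (s * distinct D))
                                                       ≡⟨ factor s (distinct E) (distinct B) (distinct A) (distinct D) ⟩
      2 * (s * (distinct E + (distinct B + distinct A + distinct D)))
                                                       ≤⟨ *-monoʳ-≤ 2 (*-monoʳ-≤ s (+-monoʳ-≤ (distinct E) exchange)) ⟩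
      2 * (s * (distinct E + (distinct (B ++ D) + AD)))
                                                       ≡⟨ factor′ s (distinct E) (distinct (B ++ D)) AD ⟩
      2 * (s * (distinct E + distinct (B ++ D))) + 2 * (s * AD)
                                                       ≤⟨ +-monoˡ-≤ (2 * (s * AD)) (*-monoʳ-≤ 2 (*-monoʳ-≤ s (distinct-++-disjoint E∥BD))) ⟩
      2 * (s * distinct (E ++ B ++ D)) + 2 * (s * AD)  ∎)
      where
      open ≤-Reasoning
      AD = distinct (A ++ D)
      -- Submodularity, with `B` and `A` disjoint. The left side is worth 6 units and `AD` at most
      -- 3, so `B ++ D` is worth at least 3, and the disjoint `E` adds 2.
      exchange : distinct B + distinct A + distinct D ≤ distinct (B ++ D) + AD
      exchange = ≤-trans
        (+-monoˡ-≤ (distinct D) (≤-trans (distinct-++-disjoint B∥A)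
          (distinct-mono {B ++ A} {B ++ A ++ D} λ z∈ → case ∈-++⁻ B z∈ of λ
            { (inj₁ p) → ∈-++⁺ˡ p ; (inj₂ q) → ∈-++⁺ʳ B (∈-++⁺ˡ q) })))
        (distinct-submodular B A D)
      regroup : ∀ d → 5 * d + 3 * d ≡ 2 * d + (2 * (d + d) + 2 * d)
      regroup = ℕSolver.solve-∀
      factor : ∀ s c b a δ → 2 * (s * c) + (2 * (s * b + s * a) + 2 * (s * δ)) ≡ 2 * (s * (c + (b + a + δ)))
      factor = ℕSolver.solve-∀
      factor′ : ∀ s c x y → 2 * (s * (c + (x + y))) ≡ 2 * (s * (c + x)) + 2 * (s * y)
      factor′ = ℕSolver.solve-∀

    -- Palettes for the offline coloring of a level

    module Tiling (m : ℕ) where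

      At : ℕ → ℕ → Colored → Set
      At a b x = lo (proj₁ x) ≡ a × hi (proj₁ x) ≡ b

      -- The highest and the lowest of `suc (suc m)` palettes. Copies that are not raised avoid the
      -- highest and raised ones avoid the lowest, so a top layer has to stay clear of raised copies
      -- only, and a bottom layer of the others.
      Top Bottom : ℕ → ℕ → Colored → Set
      Top    a b x = At a b x × suc m * Q ≤ proj₂ x × proj₂ x < suc (suc m) * Q
      Bottom a b x = At a b x × proj₂ x < Q

      Q≤ : ∀ n → Q ≤ suc n * Q
      Q≤ n = m≤m+n Q (n * Q)

      paint-bottom : ∀ {H a b e ys} → Layer H a b e ys → Painted (Bottom a b) ys
      paint-bottom L = painted-items (λ { refl p → p }) (Layer.located L) (Layer.paint L)

      paint-top : ∀ {H a b e ys} → Layer H a b e ys → Painted (Top a b) ys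
      paint-top L = painted-map
        (λ { (y , (at , lt) , refl) → at , m≤m+n (suc m * Q) (proj₂ y)
                                     , subst (suc m * Q + proj₂ y <_) (+-comm (suc m * Q) Q) (+-monoʳ-< (suc m * Q) lt) })
        (painted-shift (suc m * Q) (paint-bottom L))

      Apart : ℕ → ℕ → ℕ → ℕ → Set
      Apart a b a′ b′ = b < a′ ⊎ b′ < a

      at-apart : ∀ {a b a′ b′ x y} → Apart a b a′ b′ → At a b x → At a′ b′ y → ¬ Meets x y
      at-apart (inj₁ lt) (refl , refl) (refl , refl) ((_ , y≤x) , _) = <⇒≱ lt y≤x
      at-apart (inj₂ lt) (refl , refl) (refl , refl) ((x≤y , _) , _) = <⇒≱ lt x≤y

      bottom-top : ∀ {a b a′ b′ x y} → Bottom a b x → Top a′ b′ y → ¬ Meets x y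
      bottom-top (_ , lt) (_ , ge , _) (_ , e) = <⇒≱ (<-≤-trans lt (Q≤ m)) (≤-trans ge (≤-reflexive (sym e)))

      top-bottom : ∀ {a b a′ b′ x y} → Top a b x → Bottom a′ b′ y → ¬ Meets x y
      top-bottom {x = x} {y} t u mt = bottom-top {x = y} {x} u t (meets-sym x y mt)

      module _ {F : Copy m → Set} (F? : ∀ c → Dec (F c)) where

        Clear : ℕ → ℕ → Copy m → Set
        Clear a b c = end c ≤ a ⊎ b ≤ start c

        clear : ∀ {a b c x y} → Clear a b c → At a b x → Inside c y → ¬ Overlap (proj₁ x) (proj₁ y)
        clear (inj₁ ≤a) (refl , refl) (_ , <e) (x≤y , _) = <⇒≱ (<-≤-trans <e ≤a) x≤y
        clear (inj₂ b≤) (refl , refl) (s< , _) (_ , y≤x) = <⇒≱ (≤-<-trans b≤ s<) y≤x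

        top-copy : ∀ {a b c x y} → (F c → Clear a b c) → Top a b x → Raised F? c y → ¬ Meets x y
        top-copy {c = c} {x} {y} cl (at , _) (i , inj₁ (f , _)) (o , _) = clear {c = c} {x} {y} (cl f) at i o
        top-copy _ (_ , ge , _) (_ , inj₂ (_ , lt)) (_ , e) = <⇒≱ lt (≤-trans ge (≤-reflexive e))

        bottom-copy : ∀ {a b c x y} → (¬ F c → Clear a b c) → Bottom a b x → Raised F? c y → ¬ Meets x y
        bottom-copy {c = c} {x} {y} cl (at , _) (i , inj₂ (¬f , _)) (o , _) = clear {c = c} {x} {y} (cl ¬f) at i o
        bottom-copy _ (_ , lt) (_ , inj₁ (_ , ge , _)) (_ , e) = <⇒≱ lt (≤-trans ge (≤-reflexive (sym e)))

        raised-bound : ∀ {c x} → Raised F? c x → proj₂ x < suc (suc m) * Q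
        raised-bound (_ , inj₁ (_ , _ , lt)) = lt
        raised-bound (_ , inj₂ (_ , lt)) = ≤-trans lt (m≤n+m _ Q)

    disjoint-++ˡ : ∀ {X X′ Y} → Disjoint X Y → Disjoint X′ Y → Disjoint (X ++ X′) Y
    disjoint-++ˡ {X} p q z∈ = [ p , q ]′ (∈-++⁻ X z∈)

    disjoint-++ʳ : ∀ {X Y Y′} → Disjoint X Y → Disjoint X Y′ → Disjoint X (Y ++ Y′)
    disjoint-++ʳ {Y = Y} p q z∈ z∈Y = [ p z∈ , q z∈ ]′ (∈-++⁻ Y z∈Y)

    ++-⊆ : ∀ {A : Set} {xs ys zs : List A} → xs ⊆ zs → ys ⊆ zs → xs ++ ys ⊆ zs
    ++-⊆ {xs = xs} p q z∈ = [ p , q ]′ (∈-++⁻ xs z∈)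

    palette-⊆ : ∀ {xs ys} → xs ⊆ ys → palette xs ⊆ palette ys
    palette-⊆ sub z∈ with x , x∈ , refl ← ∈-map⁻ proj₂ z∈ = ∈-map⁺ proj₂ (sub x∈)

    -- Layer A covers P₁ and layer D covers P₄, both of scale e₁. If A and D together
    -- use many colors (Case₁), one layer Z joins them. Otherwise (Case₂) A and D have
    -- similar colors; layers B over P₂ and G over P₃ join them, B touching A, and G
    -- touching B and D. Any copy that lies in between is covered by one of the layers.
    module Grow (m l t : ℕ) (H : Hist) (room : d * (suc d * scale (suc m)) ≤ W)
                (cs : List (Copy m)) (sorted : AllPairs (λ c c′ → c′ ≺ c) cs)
                (starts : ∀ {c} → c ∈ cs → l < start c) (ends : ∀ {c} → c ∈ cs → end c ≤ t)
                (P₁ P₂ P₃ P₄ : Copy m) (∈₁ : P₁ ∈ cs) (∈₂ : P₂ ∈ cs) (∈₃ : P₃ ∈ cs) (∈₄ : P₄ ∈ cs)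
                (₁≺₂ : P₁ ≺ P₂) (₂≺₃ : P₂ ≺ P₃) (₃≺₄ : P₃ ≺ P₄)
                (like₂ : palette (body P₁) ⊆ palette (body P₂)) (like₃ : palette (body P₁) ⊆ palette (body P₃))
                (like₄ : palette (body P₁) ⊆ palette (body P₄)) where
      open Tiling m

      -- A layer of one of these scales clashes with everything of a smaller scale that it touches.
      -- `e₃` unfolds to `scale (suc m)`.
      e₁ e₂ e₃ : ℕ
      e₁ = suc d * scale m
      e₂ = suc d * e₁
      e₃ = suc d * e₂

      e₁≤e₂ : e₁ ≤ e₂
      e₁≤e₂ = m≤n*m e₁ (suc d)
      e₂≤e₃ : e₂ ≤ e₃
      e₂≤e₃ = m≤n*m e₂ (suc d)
      0<e₁ : 0 < e₁
      0<e₁ = ≤-trans (0<scaleFor d m) (m≤n*m (scale m) (suc d))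
      0<e₂ : 0 < e₂
      0<e₂ = ≤-trans 0<e₁ e₁≤e₂
      0<e₃ : 0 < e₃
      0<e₃ = ≤-trans 0<e₂ e₂≤e₃

      room-for : ∀ {e} → e ≤ e₃ → d * (suc d * e) ≤ W
      room-for e≤ = ≤-trans (*-monoʳ-≤ d (*-monoʳ-≤ (suc d) e≤)) room

      step₁ : d * scale m < e₁
      step₁ = e<suc (scale m) (0<scaleFor d m)
      step₂ : d * e₁ < e₂
      step₂ = e<suc e₁ 0<e₁
      step₃ : d * e₂ < e₃
      step₃ = e<suc e₂ 0<e₂

      s₁≤e₁ : start P₁ ≤ end P₁
      s₁≤e₁ = <⇒≤ (l<r P₁)
      s₄≤e₄ : start P₄ ≤ end P₄
      s₄≤e₄ = <⇒≤ (l<r P₄)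
      end₁<end₂ : end P₁ < end P₂
      end₁<end₂ = ≤-<-trans ₁≺₂ (l<r P₂)
      end₂<start₄ : end P₂ < start P₄
      end₂<start₄ = ≤-<-trans ₂≺₃ (<-≤-trans (l<r P₃) ₃≺₄)
      end₁<start₄ : end P₁ < start P₄
      end₁<start₄ = <-trans end₁<end₂ end₂<start₄

      -- Copies are linearly ordered and do not overlap, so none straddles an end of another. This
      -- and `by-end` handle the copies that are not among the four.
      by-start : ∀ {c P} → c ∈ cs → P ∈ cs → end c ≤ start P ⊎ start P ≤ start c
      by-start {c} {P} c∈ P∈ with allPairs-compare sorted c∈ P∈
      ... | inj₁ refl        = inj₂ ≤-refl
      ... | inj₂ (inj₁ P≺c)  = inj₂ (≤-trans (<⇒≤ (l<r P)) P≺c)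
      ... | inj₂ (inj₂ c≺P)  = inj₁ c≺P

      by-end : ∀ {c P} → c ∈ cs → P ∈ cs → end c ≤ end P ⊎ end P ≤ start c
      by-end {c} {P} c∈ P∈ with allPairs-compare sorted c∈ P∈
      ... | inj₁ refl        = inj₁ ≤-refl
      ... | inj₂ (inj₁ P≺c)  = inj₂ P≺c
      ... | inj₂ (inj₂ c≺P)  = inj₁ (≤-trans c≺P (<⇒≤ (l<r P)))

      In : Colored → Set
      In x = (l < lo (proj₁ x) × hi (proj₁ x) < suc t) × Peak e₃ (proj₁ x)

      bodies-in : ∀ {x} → x ∈ bodies cs → In x
      bodies-in {x} x∈ with c , c∈ , x∈c ← bodies⁻ cs x∈ =
        ( <-trans (starts c∈) (proj₁ (within c x∈c))
        , m≤n⇒m≤1+n (≤-trans (proj₂ (within c x∈c)) (ends c∈)))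
        , peak-mono {I = proj₁ x} (≤-trans (m≤n*m (scale m) (suc d)) (≤-trans e₁≤e₂ e₂≤e₃)) (peaked c x∈c)

      layer-in : ∀ {H a b e ys} → Layer H a b e ys → l < a → b ≤ t → e ≤ e₃ → ∀ {x} → x ∈ ys → In x
      layer-in L l<a b≤t e≤ {x} x∈ = (case Layer.located L x∈ of λ { (refl , refl) → l<a , s≤s b≤t })
                               , peak-mono {I = proj₁ x} e≤ (Layer.peaked L x∈)

      A-in : ∀ {H ys} → Layer H (start P₁) (end P₁) e₁ ys → ∀ {x} → x ∈ ys → In x
      A-in L = layer-in L (starts ∈₁) (ends ∈₁) (≤-trans e₁≤e₂ e₂≤e₃)
      D-in : ∀ {H ys} → Layer H (start P₄) (end P₄) e₁ ys → ∀ {x} → x ∈ ys → In x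
      D-in L = layer-in L (starts ∈₄) (ends ∈₄) (≤-trans e₁≤e₂ e₂≤e₃)
      l<end₁ : l < end P₁
      l<end₁ = <-trans (starts ∈₁) (l<r P₁)
      start₄≤t : start P₄ ≤ t
      start₄≤t = ≤-trans s₄≤e₄ (ends ∈₄)

      assemble : ∀ {ys} → (∀ {x} → x ∈ ys → In x) → (5 * suc m + 2) * d ≤ 2 * (s * distinct (palette ys)) →
              Painted (λ x → proj₂ x < suc (suc m) * Q) ys → Tower (suc m) l (suc t) ys
      assemble in′ many paint = record
        { l<r    = <-trans l<end₁ (s≤s (ends ∈₁))
        ; within = proj₁ ∘ in′
        ; peaked = proj₂ ∘ in′
        ; many   = many
        ; paint  = paint
        }

      module Case₁ {aa dd zz} (A : Layer (bodies cs ++ H) (start P₁) (end P₁) e₁ aa)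
                   (D : Layer (aa ++ bodies cs ++ H) (start P₄) (end P₄) e₁ dd)
                   (varied : 3 * d ≤ 2 * (s * distinct (palette aa ++ palette dd)))
                   (Z : Layer (dd ++ aa ++ bodies cs ++ H) (end P₁) (start P₄) e₂ zz) where

        -- The copies under `Z`. It takes the bottom palette, since it touches both `A` and `D`,
        -- which are apart and share the top one.
        F : Copy m → Set
        F c = end P₁ ≤ start c × start c < start P₄
        F? : ∀ c → Dec (F c)
        F? c = (end P₁ ≤? start c) ×-dec (start c <? start P₄)

        D-clear : ∀ {c} → c ∈ cs → F c → Clear F? (start P₄) (end P₄) c
        D-clear c∈ (_ , lt) = [ inj₁ , (λ ge → ⊥-elim (<⇒≱ lt ge)) ]′ (by-start c∈ ∈₄)

        Z-clear : ∀ {c} → c ∈ cs → ¬ F c → Clear F? (end P₁) (start P₄) c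
        Z-clear {c} c∈ ¬f with by-end c∈ ∈₁ | start P₄ ≤? start c
        ... | inj₁ p | _     = inj₁ p
        ... | inj₂ _ | yes q = inj₂ q
        ... | inj₂ p | no ¬q = ⊥-elim (¬f (p , ≰⇒> ¬q))

        ys : List Colored
        ys = zz ++ dd ++ aa ++ bodies cs

        painted : Painted (λ x → proj₂ x < suc (suc m) * Q) ys
        painted = painted-map
          (λ { (inj₁ (_ , lt)) → <-≤-trans lt (Q≤ (suc m))
             ; (inj₂ (inj₁ (_ , _ , lt))) → lt
             ; (inj₂ (inj₂ (inj₁ (_ , _ , lt)))) → lt
             ; {x} (inj₂ (inj₂ (inj₂ (c , _ , r)))) → raised-bound F? {c} {x} r })
          (painted-++ (λ { {x} {y} z (inj₁ δ) → bottom-top {x = x} {y} z δ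
                         ; {x} {y} z (inj₂ (inj₁ a)) → bottom-top {x = x} {y} z a
                         ; {x} {y} z (inj₂ (inj₂ (c , c∈ , r))) → bottom-copy F? {c = c} {x} {y} (Z-clear c∈) z r })
            (paint-bottom Z)
          (painted-++ (λ { {x} {y} (δ , _) (inj₁ (a , _)) → at-apart {x = x} {y} (inj₂ end₁<start₄) δ a
                         ; {x} {y} δ (inj₂ (c , c∈ , r)) → top-copy F? {c = c} {x} {y} (D-clear c∈) δ r })
            (paint-top D)
          (painted-++ (λ { {x} {y} a (c , c∈ , r) → top-copy F? {c = c} {x} {y} (λ f → inj₂ (proj₁ f)) a r })
            (paint-top A)
            (paint-copies F? cs sorted))))

        copy⊆ : ∀ {P} → P ∈ cs → body P ⊆ bodies cs ++ H
        copy⊆ P∈ x∈ = ∈-++⁺ˡ (body⊆bodies P∈ x∈)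

        many-colors : (5 * suc m + 2) * d ≤ 2 * (s * distinct (palette ys))
        -- All gains are measured against the palette of `P₁`: the layers `A`, `Z` and `D` cover
        -- `P₁`, `P₂` and `P₄`, whose palettes contain it.
        many-colors = tower-gain m {palette zz ++ (palette aa ++ palette dd)}
          {palette (body P₁)} (Tower.many (Copy.tower P₁))
          (gain-varied {palette zz} varied (Layer.many Z)
            (disjoint-++ʳ {palette zz} {palette aa}
              (layer-vs-layer Z A (∈-++⁺ʳ dd ∘ ∈-++⁺ˡ) step₂ ≤-refl (≤-trans s₁≤e₁ (<⇒≤ end₁<start₄)))
              (layer-vs-layer Z D ∈-++⁺ˡ step₂ (≤-trans (<⇒≤ end₁<start₄) s₄≤e₄) ≤-refl)))
          (disjoint-++ˡ {palette zz}
            (λ z∈ k∈ → layer-vs-copy P₂ Z (∈-++⁺ʳ dd ∘ ∈-++⁺ʳ aa ∘ copy⊆ ∈₂)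
                         (<-≤-trans step₁ e₁≤e₂) ₁≺₂ (<⇒≤ end₂<start₄) z∈ (like₂ k∈))
            (disjoint-++ˡ {palette aa}
              (layer-vs-copy P₁ A (copy⊆ ∈₁) step₁ ≤-refl ≤-refl)
              (λ z∈ k∈ → layer-vs-copy P₄ D (∈-++⁺ʳ aa ∘ copy⊆ ∈₄) step₁ ≤-refl ≤-refl z∈ (like₄ k∈))))
          (++-⊆ {xs = palette zz ++ (palette aa ++ palette dd)}
            (++-⊆ {xs = palette zz} (palette-⊆ {zz} ∈-++⁺ˡ)
              (++-⊆ {xs = palette aa} (palette-⊆ {aa} (∈-++⁺ʳ zz ∘ ∈-++⁺ʳ dd ∘ ∈-++⁺ˡ))
                                      (palette-⊆ {dd} (∈-++⁺ʳ zz ∘ ∈-++⁺ˡ))))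
            (palette-⊆ {body P₁} (∈-++⁺ʳ zz ∘ ∈-++⁺ʳ dd ∘ ∈-++⁺ʳ aa ∘ body⊆bodies ∈₁)))

        result : Tower (suc m) l (suc t) ys
        result = assemble (++-all zz (layer-in Z l<end₁ start₄≤t e₂≤e₃)
                            (++-all dd (D-in D) (++-all aa (A-in A) bodies-in)))
                       many-colors painted

      module Case₂ {aa dd bb gg} (A : Layer (bodies cs ++ H) (start P₁) (end P₁) e₁ aa)
                   (D : Layer (aa ++ bodies cs ++ H) (start P₄) (end P₄) e₁ dd)
                   (similar : 2 * (s * distinct (palette aa ++ palette dd)) ≤ 3 * d)
                   (B : Layer (dd ++ aa ++ bodies cs ++ H) (end P₁) (end P₂) e₂ bb)
                   (G : Layer (bb ++ dd ++ aa ++ bodies cs ++ H) (end P₂) (start P₄) e₃ gg) where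

        -- The copies under the bottom layers `B` and `D`, and all copies further right, which no
        -- layer covers. `A` and `G` take the top palette.
        F : Copy m → Set
        F c = (end P₁ ≤ start c × start c < end P₂) ⊎ start P₄ ≤ start c
        F? : ∀ c → Dec (F c)
        F? c = ((end P₁ ≤? start c) ×-dec (start c <? end P₂)) ⊎-dec (start P₄ ≤? start c)

        A-clear : ∀ {c} → F c → Clear F? (start P₁) (end P₁) c
        A-clear (inj₁ (p , _)) = inj₂ p
        A-clear (inj₂ p)       = inj₂ (≤-trans (<⇒≤ end₁<start₄) p)

        G-clear : ∀ {c} → c ∈ cs → F c → Clear F? (end P₂) (start P₄) c
        G-clear c∈ (inj₁ (_ , lt)) = [ inj₁ , (λ ge → ⊥-elim (<⇒≱ lt ge)) ]′ (by-end c∈ ∈₂)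
        G-clear c∈ (inj₂ p)        = inj₂ p

        B-clear : ∀ {c} → c ∈ cs → ¬ F c → Clear F? (end P₁) (end P₂) c
        B-clear {c} c∈ ¬f with by-end c∈ ∈₁ | end P₂ ≤? start c
        ... | inj₁ p | _     = inj₁ p
        ... | inj₂ _ | yes q = inj₂ q
        ... | inj₂ p | no ¬q = ⊥-elim (¬f (inj₁ (p , ≰⇒> ¬q)))

        D-clear : ∀ {c} → c ∈ cs → ¬ F c → Clear F? (start P₄) (end P₄) c
        D-clear c∈ ¬f = [ inj₁ , (λ ge → ⊥-elim (¬f (inj₂ ge))) ]′ (by-start c∈ ∈₄)

        ys : List Colored
        ys = gg ++ bb ++ dd ++ aa ++ bodies cs

        painted : Painted (λ x → proj₂ x < suc (suc m) * Q) ys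
        painted = painted-map
          (λ { (inj₁ (_ , _ , lt)) → lt
             ; (inj₂ (inj₁ (_ , lt))) → <-≤-trans lt (Q≤ (suc m))
             ; (inj₂ (inj₂ (inj₁ (_ , lt)))) → <-≤-trans lt (Q≤ (suc m))
             ; (inj₂ (inj₂ (inj₂ (inj₁ (_ , _ , lt))))) → lt
             ; {x} (inj₂ (inj₂ (inj₂ (inj₂ (c , _ , r))))) → raised-bound F? {c} {x} r })
          (painted-++ (λ { {x} {y} g (inj₁ b) → top-bottom {x = x} {y} g b
                         ; {x} {y} g (inj₂ (inj₁ δ)) → top-bottom {x = x} {y} g δ
                         ; {x} {y} (g , _) (inj₂ (inj₂ (inj₁ (a , _)))) → at-apart {x = x} {y} (inj₂ end₁<end₂) g a
                         ; {x} {y} g (inj₂ (inj₂ (inj₂ (c , c∈ , r)))) → top-copy F? {c = c} {x} {y} (G-clear c∈) g r })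
            (paint-top G)
          (painted-++ (λ { {x} {y} (b , _) (inj₁ (δ , _)) → at-apart {x = x} {y} (inj₁ end₂<start₄) b δ
                         ; {x} {y} b (inj₂ (inj₁ a)) → bottom-top {x = x} {y} b a
                         ; {x} {y} b (inj₂ (inj₂ (c , c∈ , r))) → bottom-copy F? {c = c} {x} {y} (B-clear c∈) b r })
            (paint-bottom B)
          (painted-++ (λ { {x} {y} δ (inj₁ a) → bottom-top {x = x} {y} δ a
                         ; {x} {y} δ (inj₂ (c , c∈ , r)) → bottom-copy F? {c = c} {x} {y} (D-clear c∈) δ r })
            (paint-bottom D)
          (painted-++ (λ { {x} {y} a (c , c∈ , r) → top-copy F? {c = c} {x} {y} (A-clear {c}) a r })
            (paint-top A)
            (paint-copies F? cs sorted)))))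

        copy⊆ : ∀ {P} → P ∈ cs → body P ⊆ bodies cs ++ H
        copy⊆ P∈ x∈ = ∈-++⁺ˡ (body⊆bodies P∈ x∈)

        many-colors : (5 * suc m + 2) * d ≤ 2 * (s * distinct (palette ys))
        -- The gain comes from `G`, `B` and `D`, which cover `P₃`, `P₂` and `P₄`; `A` serves to keep
        -- `B` away from the colors that `A` and `D` have in common.
        many-colors = tower-gain m {palette gg ++ (palette bb ++ palette dd)}
          {palette (body P₁)} (Tower.many (Copy.tower P₁))
          (gain-similar {palette aa} {palette bb} {palette gg} {palette dd} similar
            (Layer.many A) (Layer.many B) (Layer.many G) (Layer.many D)
            (layer-vs-layer B A (∈-++⁺ʳ dd ∘ ∈-++⁺ˡ) step₂ ≤-refl (≤-trans s₁≤e₁ (<⇒≤ end₁<end₂)))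
            (disjoint-++ʳ {palette gg} {palette bb}
              (layer-vs-layer G B ∈-++⁺ˡ step₃ ≤-refl (<⇒≤ end₁<start₄))
              (layer-vs-layer G D (∈-++⁺ʳ bb ∘ ∈-++⁺ˡ) (<-≤-trans step₂ e₂≤e₃)
                (≤-trans (<⇒≤ end₂<start₄) s₄≤e₄) ≤-refl)))
          (disjoint-++ˡ {palette gg}
            (λ z∈ k∈ → layer-vs-copy P₃ G (∈-++⁺ʳ bb ∘ ∈-++⁺ʳ dd ∘ ∈-++⁺ʳ aa ∘ copy⊆ ∈₃)
                         (<-≤-trans step₁ (≤-trans e₁≤e₂ e₂≤e₃)) ₂≺₃ ₃≺₄ z∈ (like₃ k∈))
            (disjoint-++ˡ {palette bb}
              (λ z∈ k∈ → layer-vs-copy P₂ B (∈-++⁺ʳ dd ∘ ∈-++⁺ʳ aa ∘ copy⊆ ∈₂)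
                           (<-≤-trans step₁ e₁≤e₂) ₁≺₂ ≤-refl z∈ (like₂ k∈))
              (λ z∈ k∈ → layer-vs-copy P₄ D (∈-++⁺ʳ aa ∘ copy⊆ ∈₄) step₁ ≤-refl ≤-refl z∈ (like₄ k∈))))
          (++-⊆ {xs = palette gg ++ (palette bb ++ palette dd)}
            (++-⊆ {xs = palette gg} (palette-⊆ {gg} ∈-++⁺ˡ)
              (++-⊆ {xs = palette bb} (palette-⊆ {bb} (∈-++⁺ʳ gg ∘ ∈-++⁺ˡ))
                                      (palette-⊆ {dd} (∈-++⁺ʳ gg ∘ ∈-++⁺ʳ bb ∘ ∈-++⁺ˡ))))
            (palette-⊆ {body P₁} (∈-++⁺ʳ gg ∘ ∈-++⁺ʳ bb ∘ ∈-++⁺ʳ dd ∘ ∈-++⁺ʳ aa ∘ body⊆bodies ∈₁)))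

        result : Tower (suc m) l (suc t) ys
        result = assemble (++-all gg (layer-in G (<-trans l<end₁ end₁<end₂) start₄≤t ≤-refl)
                            (++-all bb (layer-in B l<end₁ (≤-trans (<⇒≤ end₂<start₄) start₄≤t) e₂≤e₃)
                            (++-all dd (D-in D) (++-all aa (A-in A) bodies-in)))) many-colors painted

      Goal : Hist → Hist → Set
      Goal = Extends (λ ys → ∃[ r ] Tower (suc m) l r ys)

      grow : Force (Goal H) (bodies cs ++ H)
      grow =
        layer (bodies cs ++ H) (start P₁) (end P₁) e₁ s₁≤e₁ 0<e₁ (room-for (≤-trans e₁≤e₂ e₂≤e₃))
          >>= λ { (aa , refl , A) →
        layer (aa ++ bodies cs ++ H) (start P₄) (end P₄) e₁ s₄≤e₄ 0<e₁ (room-for (≤-trans e₁≤e₂ e₂≤e₃))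
          >>= λ { (dd , refl , D) →
        case 3 * d ≤? 2 * (s * distinct (palette aa ++ palette dd)) of λ
          { (yes varied) →
              layer (dd ++ aa ++ bodies cs ++ H) (end P₁) (start P₄) e₂ (<⇒≤ end₁<start₄) 0<e₂ (room-for e₂≤e₃)
                >>= λ { (zz , refl , Z) →
              done (_ , assoc₃ zz dd aa (bodies cs) H , suc t , Case₁.result A D varied Z) }
          ; (no ¬varied) →
              layer (dd ++ aa ++ bodies cs ++ H) (end P₁) (end P₂) e₂ (<⇒≤ end₁<end₂) 0<e₂ (room-for e₂≤e₃)
                >>= λ { (bb , refl , B) →
              layer (bb ++ dd ++ aa ++ bodies cs ++ H) (end P₂) (start P₄) e₃ (<⇒≤ end₂<start₄) 0<e₃ (room-for ≤-refl)
                >>= λ { (gg , refl , G) →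
              done (_ , assoc₄ gg bb dd aa (bodies cs) H , suc t , Case₂.result A D (<⇒≤ (≰⇒> ¬varied)) B G) } } } } }
        where
        assoc₂ : ∀ (a b c : Hist) e → a ++ b ++ c ++ e ≡ (a ++ b ++ c) ++ e
        assoc₂ a b c e = trans (cong (a ++_) (sym (++-assoc b c e))) (sym (++-assoc a (b ++ c) e))
        assoc₃ : ∀ (z a b c : Hist) e → z ++ a ++ b ++ c ++ e ≡ (z ++ a ++ b ++ c) ++ e
        assoc₃ z a b c e = trans (cong (z ++_) (assoc₂ a b c e)) (sym (++-assoc z (a ++ b ++ c) e))
        assoc₄ : ∀ (y z a b c : Hist) e → y ++ z ++ a ++ b ++ c ++ e ≡ (y ++ z ++ a ++ b ++ c) ++ e
        assoc₄ y z a b c e = trans (cong (y ++_) (assoc₃ z a b c e)) (sym (++-assoc y (z ++ a ++ b ++ c) e))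

    -- Building towers of every level

    record Copies (m l n : ℕ) (H H′ : Hist) : Set where
      field
        copies  : List (Copy m)
        number  : length copies ≡ n
        history : H′ ≡ bodies copies ++ H
        sorted  : AllPairs (λ c c′ → c′ ≺ c) copies
        starts  : ∀ {c} → c ∈ copies → l ≤ start c
        reach   : ℕ
        l≤reach : l ≤ reach
        ends    : ∀ {c} → c ∈ copies → end c ≤ reach

    copies-of : ∀ {m} l → (∀ H l → Force (Extends (λ ys → ∃[ r ] Tower m l r ys) H) H) →
                ∀ n H → Force (Copies m l n H) H
    copies-of l build zero H = done (record
      { copies = [] ; number = refl ; history = refl ; sorted = [] ; starts = λ ()
      ; reach = l ; l≤reach = ≤-refl ; ends = λ () })
    copies-of l build (suc n) H = copies-of l build n H >>= λ {H′} K →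
      let open Copies K in build H′ reach >>= λ { (ys , eq , r , T) →
        let new = record { start = reach ; end = r ; body = ys ; tower = T } in done (record
          { copies  = new ∷ copies
          ; number  = cong suc number
          ; history = trans eq (trans (cong (ys ++_) history) (sym (++-assoc ys _ H)))
          ; sorted  = All.tabulate ends ∷ sorted
          ; starts  = λ { (here refl) → l≤reach ; (there c∈) → starts c∈ }
          ; reach   = r
          ; l≤reach = ≤-trans l≤reach (<⇒≤ (Tower.l<r T))
          ; ends    = λ { (here refl) → ≤-refl ; (there c∈) → ≤-trans (ends c∈) (<⇒≤ (Tower.l<r T)) }
          }) }

    base-tower : d * (suc d * 1) ≤ W → ∀ H l → Force (Extends (λ ys → ∃[ r ] Tower 0 l r ys) H) H
    base-tower room H l = layer H (suc l) (suc l) 1 ≤-refl (s≤s z≤n) room >>= λ { (ys , eq , L) →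
      done (ys , eq , suc (suc l) , record
        { l<r    = m≤n⇒m≤1+n ≤-refl
        ; within = λ x∈ → case Layer.located L x∈ of λ { (p , q) → ≤-reflexive (sym p) , s≤s (≤-reflexive q) }
        ; peaked = Layer.peaked L
        ; many   = *-monoʳ-≤ 2 (Layer.many L)
        ; paint  = painted-map (λ lt → ≤-trans lt (m≤m+n Q 0)) (Layer.paint L)
        }) }

    -- If the copies together already have the colors of the next level, no layer is added. Being
    -- disjoint, they share the lower palettes and none is raised.
    saturated : ∀ {m l n H H′} (K : Copies m (suc l) n H H′) →
      (5 * suc m + 2) * d ≤ 2 * (s * distinct (palette (bodies (Copies.copies K)))) →
      Tower (suc m) l (suc (Copies.reach K)) (bodies (Copies.copies K))
    saturated {m} K many = record
      { l<r    = s≤s (≤-trans (n≤1+n _) l≤reach)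
      ; within = λ x∈ → case bodies⁻ copies x∈ of λ { (c , c∈ , x∈c) →
                   <-trans (starts c∈) (proj₁ (within c x∈c)) , m≤n⇒m≤1+n (≤-trans (proj₂ (within c x∈c)) (ends c∈)) }
      ; peaked = λ {x} x∈ → case bodies⁻ copies x∈ of λ { (c , c∈ , x∈c) →
                   peak-mono {I = proj₁ x} (scaleFor-mono d m) (peaked c x∈c) }
      ; many   = many
      ; paint  = painted-map (λ { (_ , _ , _ , inj₂ (_ , lt)) → <-≤-trans lt (m≤n+m _ Q) })
                   (paint-copies {F = λ _ → Empty.⊥} (λ _ → no λ ()) copies sorted)
      }
      where open Copies K

    build-tower : ∀ m → d * (suc d * scale m) ≤ W → ∀ H l → Force (Extends (λ ys → ∃[ r ] Tower m l r ys) H) H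
    build-tower zero    room H l = base-tower room H l
    build-tower (suc m) room H l =
      -- Copies that miss the target use fewer than `target` colors in all, so this many of them
      -- suffice for `pigeonhole` to leave four with equal palettes. Starting at `suc l` keeps them
      -- strictly to the right of `l`.
      copies-of (suc l) (build-tower m lower) (suc (3 * 2 ^ target)) H >>= λ K →
      case target ≤? 2 * (s * distinct (palette (bodies (Copies.copies K)))) of λ
        { (yes many) → done (bodies (Copies.copies K) , Copies.history K , suc (Copies.reach K) , saturated K many)
        ; (no few)   → subst (Force _) (sym (Copies.history K)) (tile K (≰⇒> few))
        }
      where
      target : ℕ
      target = (5 * suc m + 2) * d
      lower : d * (suc d * scale m) ≤ W
      lower = ≤-trans (*-monoʳ-≤ d (*-monoʳ-≤ (suc d) (scaleFor-mono d m))) room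
      tile : ∀ {H′} (K : Copies m (suc l) (suc (3 * 2 ^ target)) H H′) →
             2 * (s * distinct (palette (bodies (Copies.copies K)))) < target →
             Force (Extends (λ ys → ∃[ r ] Tower (suc m) l r ys) H) (bodies (Copies.copies K) ++ H)
      tile K few = tile′ (pigeonhole (λ u c → u ∈? palette (body c)) U copies sorted
          (subst (3 * 2 ^ length U <_) (sym number) (s≤s (*-monoʳ-≤ 3 (^-monoʳ-≤ 2 (<⇒≤ few′))))))
        where
        open Copies K
        U = deduplicate _≟_ (palette (bodies copies))
        few′ : length U < target
        few′ = ≤-<-trans (≤-trans (m≤n*m (length U) s {{>-nonZero 0<s}}) (m≤n*m (s * length U) 2)) few
        tile′ : (∃[ ps ] 3 < length ps × AllPairs (λ c c′ → c′ ≺ c) ps × ps ⊆ copies ×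
                  (∀ {u x y} → u ∈ U → x ∈ ps → y ∈ ps → u ∈ palette (body x) → u ∈ palette (body y))) →
                Force (Extends (λ ys → ∃[ r ] Tower (suc m) l r ys) H) (bodies copies ++ H)
        tile′ ([] , () , _)
        tile′ (_ ∷ [] , s≤s () , _)
        tile′ (_ ∷ _ ∷ [] , s≤s (s≤s ()) , _)
        tile′ (_ ∷ _ ∷ _ ∷ [] , s≤s (s≤s (s≤s ())) , _)
        -- The latest copy, which is the rightmost, comes first in the list.
        tile′ (P₄ ∷ P₃ ∷ P₂ ∷ P₁ ∷ _ , _ , ((₃≺₄ ∷ _) ∷ (₂≺₃ ∷ _) ∷ (₁≺₂ ∷ _) ∷ _) , sub , alike) =
          Grow.grow m l reach H room copies sorted starts ends P₁ P₂ P₃ P₄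
            (sub at₁) (sub at₂) (sub at₃) (sub at₄) ₁≺₂ ₂≺₃ ₃≺₄ (like at₂) (like at₃) (like at₄)
          where
          at₄ = here refl
          at₃ = there (here refl)
          at₂ = there (there (here refl))
          at₁ = there (there (there (here refl)))
          like : ∀ {P} → P ∈ _ → palette (body P₁) ⊆ palette (body P)
          like P∈ u∈ = alike (∈-deduplicate⁺ _≟_ (palette-⊆ {body P₁} (body⊆bodies (sub at₁)) u∈)) at₁ P∈ u∈

  -- The strategy

  module Extract (d k W : ℕ) {{W≢0 : NonZero W}} where
    open Items d k W
    open Bridge d k W

    strategy : ∀ {G H} → Force G H → D.Strategy d
    respond  : ∀ {G H I γ} → Dec (Allowed I γ H) → (Allowed I γ H → Force G ((I , γ) ∷ H)) → D.Strategy d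
    strategy         (done _)  = D.stop
    strategy {H = H} (ask I F) = D.present (toWI I) λ γ → respond (allowed? I γ H) (F γ)
    respond (yes ok) F = strategy (F ok)
    -- A default value: by `coloring⇒allowed`, no valid answer leads here.
    respond (no _)   _ = D.stop

    Wins : (c x : ℝ) → Hist → Set
    Wins c x H = c D.≤ fromℕ (D.#colors (colors H)) × D.Colorable k x (intervals (items H))

    strategy-forces : ∀ {G H c x} (t : Force G H) → (∀ {H′} → G H′ → Wins c x H′) →
      D.ForcesFrom k c x (intervals (items H)) (colors H) (strategy t)
    strategy-forces (done g) wins = wins g
    strategy-forces {G} {H} {c} {x} (ask I F) wins γ valid = go (allowed? I γ H)
      where
      go : (a : Dec (Allowed I γ H)) →
           D.ForcesFrom k c x (toWI I Vec.∷ intervals (items H)) (γ Vec.∷ colors H) (respond a (F γ))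
      go (yes ok) = strategy-forces {G} {(I , γ) ∷ H} {c} {x} (F γ ok) wins
      go (no ¬ok) = ⊥-elim (¬ok (coloring⇒allowed {I} {γ} H valid))

    forces : ∀ {G c x} → Force G [] → (∀ {H} → G H → Wins c x H) → ∃[ σ ] D.Forces {d} k c x σ
    forces {G} {c} {x} t wins = strategy t , strategy-forces {G} {[]} {c} {x} t wins

    #colors-distinct : ∀ H → D.#colors (colors H) ≡ distinct (map proj₂ H)
    #colors-distinct H = cong distinct (toList-colors H)
      where
      toList-colors : ∀ H → toList (colors H) ≡ map proj₂ H
      toList-colors []      = refl
      toList-colors (x ∷ H) = cong (proj₂ x ∷_) (toList-colors H)

    colorable : ∀ {n x} xs (L : List Item) → items xs ≡ L → Good xs → (∀ {y} → y ∈ xs → proj₂ y < n) →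
                fromℕ n D.≤ x → D.Colorable k x (intervals L)
    colorable {n} {x} xs L refl good bound n≤x =
        colors xs , good⇒coloring xs good
      , ≤ᴿ-trans {fromℕ (D.#colors (colors xs))} {fromℕ n} {x}
          (fromℕ-mono {D.#colors (colors xs)} {n} (≤-trans (≤-reflexive (#colors-distinct xs))
            (distinct-<-bound {n} {map proj₂ xs} (All.tabulate λ c∈ →
              case ∈-map⁻ proj₂ c∈ of λ { (y , y∈ , refl) → bound y∈ })))) n≤x

  -- Comparison with the real bounds of the theorem

  frac-* : ∀ a b → frac 1 (a * b) ≡ frac 1 a ℚ.* frac 1 b
  frac-* zero    b = sym (ℚ.*-zeroˡ (frac 1 b))
  frac-* (suc a) b = begin
    frac 1 (b + a * b)                                   ≡⟨ frac-+ 1 b (a * b) ⟩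
    frac 1 b ℚ.+ frac 1 (a * b)                          ≡⟨ cong (frac 1 b ℚ.+_) (frac-* a b) ⟩
    frac 1 b ℚ.+ frac 1 a ℚ.* frac 1 b                   ≡⟨ cong (ℚ._+ frac 1 a ℚ.* frac 1 b) (sym (ℚ.*-identityˡ (frac 1 b))) ⟩
    1ℚ ℚ.* frac 1 b ℚ.+ frac 1 a ℚ.* frac 1 b            ≡⟨ ℚ.*-distribʳ-+ (frac 1 b) 1ℚ (frac 1 a) ⟨
    (1ℚ ℚ.+ frac 1 a) ℚ.* frac 1 b                       ≡⟨ cong (ℚ._* frac 1 b) (sym (frac-+ 1 1 a)) ⟩
    frac 1 (suc a) ℚ.* frac 1 b                          ∎
    where open ≡-Reasoning

  -- Raising 2^⌊log d⌋ ≤ d to the power `suc i` shows it for each approximation of the logarithm, so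
  -- the comparisons of reals below can be made term by term.
  log₂-approx-≥ : ∀ d .{{_ : NonZero d}} i → frac 1 ⌊log₂ d ⌋ ℚ.≤ D.log₂-approx d i
  log₂-approx-≥ d i = D.ratio-≤ ⌊log₂ d ⌋ ⌊log₂ d ^ suc i ⌋ 0 i (≤-trans
    (subst (_≤ ⌊log₂ d ^ suc i ⌋) (⌊log₂[2^n]⌋≡n (⌊log₂ d ⌋ * suc i))
      (⌊log₂⌋-mono-≤ (subst (_≤ d ^ suc i) (^-*-assoc 2 ⌊log₂ d ⌋ (suc i)) (^-monoˡ-≤ (suc i) (D.2^⌊log₂⌋≤ d)))))
    (≤-reflexive (sym (*-identityʳ ⌊log₂ d ^ suc i ⌋))))

  forced : (d m : ℕ) .{{_ : NonZero d}} → ℝ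
  forced d m = (fromℕ 5 D.* fromℕ m D.- fromℕ 3) D.* (fromℕ d D.÷ (D.log₂ d D.+ fromℕ 3) [ D.0<log₂+3 d ])

  budget : (d k m : ℕ) .{{_ : NonZero d}} .{{_ : NonZero k}} → ℝ
  budget d k m = fromℕ m D.* (fromℚ (ℤ.+ d ℚ./ k) D.+ D.log₂ d D.+ fromℕ 3)

  module Game (d k M h s W : ℕ) .{{d≢0 : NonZero d}} .{{k≢0 : NonZero k}} {{W≢0 : NonZero W}}
              (2s≤h : 2 * s ≤ h) (h≤log+3 : ∀ i → frac 1 h ℚ.≤ D.log₂-approx d i ℚ.+ frac 1 3)
              (0<h : 0 < h) (0<s : 0 < s) (enough : d ≤ s * (h C s)) (room : d * (suc d * scaleFor d M) ≤ W) where

    -- With q an approximation of log d + 3, one has (5M+2)·d ≤ 2sN ≤ hN ≤ qN, and division by q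
    -- gives the claim. The factor 5m-3 is 5M+2 for m = M+1.
    lower-bound : ∀ {N} → (5 * M + 2) * d ≤ 2 * (s * N) →
      forced d (suc M) D.≤ fromℕ N
    lower-bound {N} many = ≤ᴿ-pointwise {forced d (suc M)} {fromℕ N} λ i →
      bound (D.log₂-approx d i ℚ.+ frac 1 3) (h≤log+3 i)
      where
      X≡ : frac 1 5 ℚ.* frac 1 (suc M) ℚ.- frac 1 3 ≡ frac 1 (5 * M + 2)
      X≡ = begin
        frac 1 5 ℚ.* frac 1 (suc M) ℚ.- frac 1 3            ≡⟨ cong (ℚ._- frac 1 3) (sym (frac-* 5 (suc M))) ⟩
        frac 1 (5 * suc M) ℚ.- frac 1 3                     ≡⟨ cong (λ n → frac 1 n ℚ.- frac 1 3) (shift5 M) ⟩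
        frac 1 ((5 * M + 2) + 3) ℚ.- frac 1 3               ≡⟨ cong (ℚ._- frac 1 3) (frac-+ 1 (5 * M + 2) 3) ⟩
        frac 1 (5 * M + 2) ℚ.+ frac 1 3 ℚ.- frac 1 3        ≡⟨ cancel (frac 1 (5 * M + 2)) (frac 1 3) ⟩
        frac 1 (5 * M + 2)                                  ∎
        where
        open ≡-Reasoning
        shift5 : ∀ M → 5 * suc M ≡ (5 * M + 2) + 3
        shift5 = ℕSolver.solve-∀
        open ℚSolver.+-*-Solver
        cancel : ∀ p q → (p ℚ.+ q) ℚ.- q ≡ p
        cancel = solve 2 (λ p q → (p :+ q) :- q := p) refl
      bound : ∀ q → frac 1 h ℚ.≤ q →
        (frac 1 5 ℚ.* frac 1 (suc M) ℚ.- frac 1 3) ℚ.* (frac 1 d ℚ.* D.1/-or-0 q) ℚ.≤ frac 1 N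
      bound q h≤q = ℚ.*-cancelʳ-≤-pos q {{ℚ.positive 0<q}} (begin
        (frac 1 5 ℚ.* frac 1 (suc M) ℚ.- frac 1 3) ℚ.* (frac 1 d ℚ.* D.1/-or-0 q) ℚ.* q
          ≡⟨ cong (λ p → p ℚ.* (frac 1 d ℚ.* D.1/-or-0 q) ℚ.* q) X≡ ⟩
        frac 1 (5 * M + 2) ℚ.* (frac 1 d ℚ.* D.1/-or-0 q) ℚ.* q
          ≡⟨ regroup (frac 1 (5 * M + 2)) (frac 1 d) (D.1/-or-0 q) q ⟩
        frac 1 (5 * M + 2) ℚ.* frac 1 d ℚ.* (D.1/-or-0 q ℚ.* q)
          ≡⟨ cong₂ ℚ._*_ (sym (frac-* (5 * M + 2) d)) (D.1/-or-0-inverse 0<q) ⟩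
        frac 1 ((5 * M + 2) * d) ℚ.* 1ℚ
          ≡⟨ ℚ.*-identityʳ (frac 1 ((5 * M + 2) * d)) ⟩
        frac 1 ((5 * M + 2) * d)
          ≤⟨ frac-mono 1 ((5 * M + 2) * d) (N * h) (≤-trans many (≤-trans (≤-reflexive (sym (*-assoc 2 s N)))
               (≤-trans (*-monoˡ-≤ N 2s≤h) (≤-reflexive (*-comm h N))))) ⟩
        frac 1 (N * h)
          ≡⟨ frac-* N h ⟩
        frac 1 N ℚ.* frac 1 h
          ≤⟨ ℚ.*-monoˡ-≤-nonNeg (frac 1 N) {{ℚ.nonNegative (frac-mono 1 0 N z≤n)}} h≤q ⟩
        frac 1 N ℚ.* q ∎)
        where
        open ℚ.≤-Reasoning
        0<q : 0ℚ ℚ.< q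
        0<q = ℚ.<-≤-trans (frac-mono-< 1 0<h) h≤q
        open ℚSolver.+-*-Solver
        regroup : ∀ x y r q → x ℚ.* (y ℚ.* r) ℚ.* q ≡ x ℚ.* y ℚ.* (r ℚ.* q)
        regroup = solve 4 (λ x y r q → x :* (y :* r) :* q := x :* y :* (r :* q)) refl

    div≤frac : ∀ d k .{{_ : NonZero k}} → frac 1 (d / k) ℚ.≤ frac k d
    div≤frac d (suc k) = D.ratio-≤ (d / suc k) d 0 k (≤-trans (m/n*n≤m d (suc k)) (≤-reflexive (sym (*-identityʳ d))))

    upper-bound : fromℕ (suc M * (h + d / k)) D.≤ budget d k (suc M)
    upper-bound = ≤ᴿ-pointwise {fromℕ (suc M * (h + d / k))} {budget d k (suc M)} λ i → begin
      frac 1 (suc M * (h + d / k))                             ≡⟨ frac-* (suc M) (h + d / k) ⟩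
      frac 1 (suc M) ℚ.* frac 1 (h + d / k)                    ≡⟨ cong (frac 1 (suc M) ℚ.*_) (frac-+ 1 h (d / k)) ⟩
      frac 1 (suc M) ℚ.* (frac 1 h ℚ.+ frac 1 (d / k))
        ≤⟨ ℚ.*-monoˡ-≤-nonNeg (frac 1 (suc M)) {{ℚ.nonNegative (frac-mono 1 0 (suc M) z≤n)}}
             (ℚ.+-mono-≤ (h≤log+3 i) (div≤frac d k)) ⟩
      frac 1 (suc M) ℚ.* (D.log₂-approx d i ℚ.+ frac 1 3 ℚ.+ frac k d)
        ≡⟨ cong (frac 1 (suc M) ℚ.*_) (rotate (D.log₂-approx d i) (frac 1 3) (frac k d)) ⟩
      frac 1 (suc M) ℚ.* (frac k d ℚ.+ D.log₂-approx d i ℚ.+ frac 1 3) ∎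
      where
      open ℚ.≤-Reasoning
      open ℚSolver.+-*-Solver
      rotate : ∀ l t q → l ℚ.+ t ℚ.+ q ≡ q ℚ.+ l ℚ.+ t
      rotate = solve 3 (λ l t q → l :+ t :+ q := q :+ l :+ t) refl

    open Towers d k W h s 0<s enough
    open Bridge d k W
    open Extract d k W

    tower-wins : ∀ {c x r} ys → Tower M 0 r ys →
      (∀ {N} → (5 * M + 2) * d ≤ 2 * (s * N) → c D.≤ fromℕ N) →
      fromℕ (suc M * (h + d / k)) D.≤ x → Wins c x ys
    tower-wins {c} {x} ys T lower upper = many-colors , painted (Tower.paint T)
      where
      many-colors : c D.≤ fromℕ (D.#colors (colors ys))
      many-colors = subst (λ n → c D.≤ fromℕ n) (sym (#colors-distinct ys))
                      (lower {distinct (palette ys)} (Tower.many T))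
      painted : Paintable (suc M * Q) ys → D.Colorable k x (intervals (items ys))
      painted (xs , eq , good , bound) = colorable {suc M * Q} {x} xs (items ys) eq good bound upper

    forcing : ∃[ σ ] D.Forces {d} k
        (forced d (suc M)) (budget d k (suc M)) σ
    forcing = forces (build-tower M room [] 0) λ { (ys , eq , _ , T) →

      subst (Wins (forced d (suc M)) (budget d k (suc M))) (sym (trans eq (++-identityʳ ys)))
        (tower-wins {forced d (suc M)} {budget d k (suc M)} ys T (λ {N} → lower-bound {N}) upper-bound) }

  log₂+3-≥ : ∀ d .{{_ : NonZero d}} {h} → h ≡ ⌊log₂ d ⌋ + 3 → ∀ i →
              frac 1 h ℚ.≤ D.log₂-approx d i ℚ.+ frac 1 3
  log₂+3-≥ d refl i =
    ℚ.≤-trans (ℚ.≤-reflexive (frac-+ 1 ⌊log₂ d ⌋ 3)) (ℚ.+-monoˡ-≤ (frac 1 3) (log₂-approx-≥ d i))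

  2*⌊n/2⌋≤n : ∀ n → 2 * ⌊ n /2⌋ ≤ n
  2*⌊n/2⌋≤n n =
    ≤-trans (+-monoʳ-≤ ⌊ n /2⌋ (≤-trans (≤-reflexive (+-identityʳ _)) (⌊n/2⌋≤⌈n/2⌉ n)))
            (≤-reflexive (⌊n/2⌋+⌈n/2⌉≡n n))

  -- Of the three extra hues, one makes up for rounding the logarithm down and two are the loss in
  -- `half-subsets`.
  enough-hues : ∀ d {h} → h ≡ 3 + ⌊log₂ d ⌋ → d ≤ ⌊ h /2⌋ * (h C ⌊ h /2⌋)
  enough-hues d eq = ≤-trans (<⇒≤ (D.<2^suc⌊log₂⌋ d))
    (subst (λ h → 2 ^ suc ⌊log₂ d ⌋ ≤ ⌊ h /2⌋ * (h C ⌊ h /2⌋)) (sym eq) (half-subsets (suc ⌊log₂ d ⌋)))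

  forcing-strategy : ∀ d k M .{{d≢0 : NonZero d}} .{{k≢0 : NonZero k}} h → h ≡ 3 + ⌊log₂ d ⌋ →
                     ∃[ σ ] D.Forces {d} k
        (forced d (suc M)) (budget d k (suc M)) σ
  forcing-strategy d k M {{d≢0}} {{k≢0}} h h≡ = Game.forcing d k M h ⌊ h /2⌋ W {{d≢0}} {{k≢0}} {{W≢0}}
    (2*⌊n/2⌋≤n h) (log₂+3-≥ d {{d≢0}} (trans h≡ (+-comm 3 ⌊log₂ d ⌋)))
    0<h 0<s (enough-hues d h≡) ≤-refl
    where
    W : ℕ
    -- Exactly the room needed by layers of the largest scale in a tower of level `M`.
    W = d * (suc d * scaleFor d M)
    instance
      scale≢0 : NonZero (scaleFor d M)
      scale≢0 = >-nonZero (0<scaleFor d M)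
    W≢0 : NonZero W
    W≢0 = m*n≢0 d (suc d * scaleFor d M) {{d≢0}} {{m*n≢0 (suc d) (scaleFor d M)}}
    0<h : 0 < h
    0<h = subst (0 <_) (sym h≡) (s≤s z≤n)
    0<s : 0 < ⌊ h /2⌋
    0<s = subst (λ h → 0 < ⌊ h /2⌋) (sym h≡) (s≤s z≤n)

open import Defs
open import Data.Integer.Base using (+_)
open import Data.Nat.Base using (ℕ; suc; NonZero; NonTrivial; nonTrivial⇒nonZero)
open import Data.Product using (∃-syntax)
open import Data.Rational.Base using (_/_)
open import Relation.Binary.PropositionalEquality using (refl)

theorem3 : ∀ (d k m : ℕ) .{{_ : NonTrivial d}} .{{_ : NonZero k}} .{{_ : NonZero m}} →
    let instance d≢0 = nonTrivial⇒nonZero d in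
    ∃[ σ ] Forces {d} k
    ((fromℕ 5 * fromℕ m - fromℕ 3) * (fromℕ d ÷ (log₂ d + fromℕ 3) [ 0<log₂+3 d ]))
    (fromℕ m * (fromℚ (+ d / k) + log₂ d + fromℕ 3))
    σ
-- A tower of level `M` is painted with `suc M` palettes, so it is the level for m = M+1.
theorem3 d k (suc M) {{nt}} {{k≢0}} =
  Forcing.forcing-strategy d k M {{nonTrivial⇒nonZero d {{nt}}}} {{k≢0}} _ refl
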